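{- Let $n \ge 4$ be an even integer. Then ${\sf s}(D_{2n} \times C_2) = 2n + 2$ and ${\sf \eta}(D_{2n} \times C_2) = n + 3$. In particular, ${\sf s}(D_{2n} \times C_2) = {\sf \eta}(D_{2n} \times C_2) + \exp(D_{2n} \times C_2) - 1$.
   Context: $D_{2n}$ is the dihedral group of order $2n$ and $C_2$ the cyclic group of order $2$. For a finite group $G$, a sequence over $G$ is a finite unordered list of elements of $G$ with repetitions allowed; for $S = g_1\cdots g_k$, $\pi(S)$ is the set of all products $g_{\tau(1)}\cdots g_{\tau(k)}$ over permutations $\tau$. ${\sf s}(G)$ is the smallest $\ell>0$ such that every sequence over $G$ of length at least $\ell$ has a subsequence $T$ of length $\exp(G)$ with $1\in\pi(T)$. ${\sf \eta}(G)$ is the smallest $\ell>0$ such that every sequence over $G$ of length at least $\ell$ has a subsequence $T$ with $1 \le |T| \le \exp(G)$ and $1 \in \pi(T)$. -}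

module Defs where

open import Data.Nat using (ℕ; zero; suc; _+_; _*_; _∸_; _≤_; _<_; NonZero)
open import Data.Nat.DivMod using (_%_; m%n<n)
open import Data.Fin using (Fin; toℕ; fromℕ<)
open import Data.Bool using (Bool; true; false; if_then_else_; _xor_)
open import Data.Product using (_×_; _,_; ∃; ∃-syntax)
open import Data.List using (List; []; _∷_; foldr; length)
open import Data.List.Relation.Binary.Sublist.Propositional using (_⊆_)
open import Data.List.Relation.Binary.Permutation.Propositional using (_↭_)
open import Relation.Binary.PropositionalEquality using (_≡_)
open import Relation.Nullary using (¬_)

-- The group D_{2n} × C_2, concretely.
-- (i , e , c) stands for x^i y^e z^c where D_{2n} = ⟨x, y | x^n = y^2 = 1, y x y⁻¹ = x⁻¹⟩
-- and C_2 = ⟨z⟩.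
module _ (n : ℕ) .{{_ : NonZero n}} where

  G : Set
  G = Fin n × Bool × Bool

  fin : ℕ → Fin n
  fin k = fromℕ< (m%n<n k n)

  addMod : Fin n → Fin n → Fin n
  addMod i j = fin (toℕ i + toℕ j)

  negMod : Fin n → Fin n
  negMod j = fin (n ∸ toℕ j)

  mul : G → G → G
  mul (i , e , c) (j , f , d) =
    (addMod i (if e then negMod j else j) , e xor f , c xor d)

  one : G
  one = (fin 0 , false , false)

  pow : G → ℕ → G
  pow g zero = one
  pow g (suc k) = mul g (pow g k)

  IsExp : ℕ → Set
  IsExp e = 0 < e × (∀ g → pow g e ≡ one)
            × (∀ k → 0 < k → k < e → ¬ (∀ g → pow g k ≡ one))

  prod : List G → G
  prod = foldr mul one

  OneInπ : List G → Set
  OneInπ T = ∃[ T' ] (T' ↭ T × prod T' ≡ one)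

  SProp : ℕ → ℕ → Set
  SProp e ℓ = ∀ (S : List G) → ℓ ≤ length S →
    ∃[ T ] (T ⊆ S × length T ≡ e × OneInπ T)

  EtaProp : ℕ → ℕ → Set
  EtaProp e ℓ = ∀ (S : List G) → ℓ ≤ length S →
    ∃[ T ] (T ⊆ S × 1 ≤ length T × length T ≤ e × OneInπ T)

IsLeastPos : (ℕ → Set) → ℕ → Set
IsLeastPos P m = 0 < m × P m × (∀ ℓ → 0 < ℓ → ℓ < m → ¬ P ℓ)

{-# OPTIONS --safe #-}
module Submission where

-- An element of D_{2n} × C₂ is lifted to D_∞ × C₂, where the product of a sequence containing a reflection
-- is xᵉ with e a signed sum of exponents whose signs can be chosen almost freely.
--
-- Upper bound for s.  If every sequence of length 2n + 2 contains a block of length n with trivial product,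
-- the same holds for nq, q prime: split off 2q − 1 such blocks and apply Erdős–Ginzburg–Ziv modulo q.
-- So n = 2p with p prime suffices.  Pair up elements congruent modulo ⟨x²⟩, a subgroup of index 8.  Either
-- there are 2p − 1 pairs and Erdős–Ginzburg–Ziv modulo p applies, or six or more elements of distinct
-- classes are left over.  Among these there are two rotations g, h and two reflections b, b′ of total class
-- zero (for p = 2, four reflections may be needed instead).  A selection of g, h, b, b′ and some pairs in
-- which p − 1 sign changes alter the exponent by a unit modulo p can be arranged to have trivial product,
-- since p − 1 units have subset sums in every residue class.  If no such selection exists, enough pairs have
-- trivial product, if need be along with g, h, b, b′.
--
-- Appending n − 1 copies of the identity turns a bound for s into one for η; the lower bounds come from the
-- sequence x^{n-1}, xz, z, y, which has no nonempty subsequence of length at most n with product one.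

open import Defs
open import Data.Nat as ℕ using (ℕ; zero; suc; z≤n; s≤s)
import Data.Nat.Properties as ℕₚ
import Data.Nat.Divisibility as ℕ∣
import Data.Nat.Tactic.RingSolver as ℕSolver
open import Data.Nat.Coprimality using (Coprime; coprime-Bézout)
open import Data.Nat.DivMod using (m≡m%n+[m/n]*n; m%n<n; m<n⇒m%n≡m)
open import Data.Nat.GCD using (module Bézout)
open import Data.Nat.ListAction using (product)
open import Data.Nat.Primality using (Prime; prime[2]; ¬prime[0]; ¬prime[1]; prime⇒irreducible; prime⇒nonZero; euclidsLemma)
open import Data.Nat.Primality.Factorisation using (PrimeFactorisation; factorise)
open import Data.Integer using (ℤ; +_; -[1+_]; -_; _+_; _-_; _*_; 0ℤ; 1ℤ; ∣_∣; _%ℕ_; _/ℕ_)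
import Data.Integer.Properties as ℤₚ
open import Data.Integer.DivMod using (a≡a%ℕn+[a/ℕn]*n; n%ℕd<d)
open import Data.Integer.Divisibility.Signed
open import Data.Integer.Tactic.RingSolver using (solve-∀)
open import Data.Bool using (Bool; true; false; not; _xor_; if_then_else_)
import Data.Bool.Properties as Boolₚ
open import Data.Fin using (toℕ)
open import Data.Fin.Properties using (toℕ-injective; toℕ-fromℕ<; toℕ<n)
open import Data.List using (List; []; _∷_; _++_; length; map; filter; take; drop; concat; concatMap; foldr; replicate)
open import Data.List.Properties as Listₚ using (length-map; length-++)
open import Data.List.Membership.Propositional using (_∈_; find; lose)
open import Data.List.Membership.Propositional.Properties
  using (∈-upTo⁺; ∈-++⁻; ∈-++⁺ˡ; ∈-++⁺ʳ; ∈-∃++; ∈-map⁺; ∈-map⁻; ∈-filter⁺; ∈-filter⁻)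
import Data.List.Membership.DecPropositional as DecMembership
open import Data.List.Relation.Unary.Any as Any using (Any; here; there; any?)
open import Data.List.Relation.Unary.All as All using (All; []; _∷_; all?)
import Data.List.Relation.Unary.All.Properties as Allₚ
open import Data.List.Relation.Unary.AllPairs as AllPairs using (AllPairs; []; _∷_)
import Data.List.Relation.Unary.AllPairs.Properties as AllPairsₚ
open import Data.List.Relation.Unary.Unique.Propositional using (Unique)
import Data.List.Relation.Unary.Unique.DecPropositional as DecUnique
open import Data.List.Relation.Binary.Pointwise using (Pointwise; []; _∷_)
open import Data.List.Relation.Binary.Sublist.Propositional using (_⊆_; []; _∷_; _∷ʳ_)
open import Data.List.Relation.Binary.Permutation.Propositional hiding (trans)
open import Data.List.Relation.Binary.Permutation.Propositional.Properties
  using (All-resp-↭; ∈-resp-↭; ↭-length; ↭-map-inv; map⁺; ++⁺; ++⁺ˡ; ++⁺ʳ; ++-comm; shift; shifts; drop-∷;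
      drop-mid)
open import Data.List.Relation.Binary.Permutation.Setoid.Properties using (Unique-resp-↭)
open import Data.Product using (_×_; _,_; ∃-syntax; Σ-syntax; proj₁; proj₂)
open import Data.Product.Properties using (≡-dec)
open import Data.Sum using (_⊎_; inj₁; inj₂)
open import Data.Empty using (⊥)
open import Function using (_∘_; id)
open import Relation.Binary.Definitions using (DecidableEquality)
open import Relation.Binary.PropositionalEquality hiding ([_])
open import Relation.Nullary using (¬_; Dec; yes; no; contradiction)
open import Relation.Nullary.Decidable using (¬?; map′; decidable-stable; from-yes; _×-dec_; _⊎-dec_)
open import Relation.Unary using (Decidable)

private variable
  A B : Set
  xs ys zs ws : List A
  a b c r s t : ℤ
  fs gs : List ℤ
  k k′ n p : ℕ

-- Sub-multisets

infix 4 _≼_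

-- Order is irrelevant in `OneInπ`, so containment is taken up to permutation; an order-preserving
-- sublist is recovered by `≼⇒⊆` only at the end.
_≼_ : List A → List A → Set
xs ≼ ys = ∃[ zs ] ys ↭ xs ++ zs

↭⇒≼ : xs ↭ ys → xs ≼ ys
↭⇒≼ {xs = xs} p = [] , ↭-trans (↭-sym p) (↭-reflexive (sym (Listₚ.++-identityʳ xs)))

≼-refl : xs ≼ xs
≼-refl = ↭⇒≼ refl

≼-trans : xs ≼ ys → ys ≼ zs → xs ≼ zs
≼-trans {xs = xs} (us , p) (vs , q) =
  us ++ vs , ↭-trans q (↭-trans (++⁺ʳ vs p) (↭-reflexive (Listₚ.++-assoc xs us vs)))

++-interchange : (xs ys zs ws : List A) → (xs ++ ys) ++ (zs ++ ws) ↭ (xs ++ zs) ++ (ys ++ ws)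
++-interchange xs ys zs ws = begin
  (xs ++ ys) ++ (zs ++ ws) ≡⟨ Listₚ.++-assoc xs ys (zs ++ ws) ⟩
  xs ++ (ys ++ (zs ++ ws)) ↭⟨ ++⁺ˡ xs (shifts ys zs) ⟩
  xs ++ (zs ++ (ys ++ ws)) ≡⟨ Listₚ.++-assoc xs zs (ys ++ ws) ⟨
  (xs ++ zs) ++ (ys ++ ws) ∎
  where open PermutationReasoning

≼-++ : xs ≼ ys → zs ≼ ws → xs ++ zs ≼ ys ++ ws
≼-++ {xs = xs} {zs = zs} (us , p) (vs , q) =
  us ++ vs , ↭-trans (++⁺ p q) (++-interchange xs us zs vs)

≼-∷ : ∀ x → xs ≼ ys → x ∷ xs ≼ x ∷ ys
≼-∷ x (us , p) = us , prep x p

++-≼ˡ : xs ≼ xs ++ ys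
++-≼ˡ {ys = ys} = ys , refl

++-≼ʳ : ys ≼ xs ++ ys
++-≼ʳ {ys = ys} {xs = xs} = xs , ++-comm xs ys

≼-length : xs ≼ ys → length xs ℕ.≤ length ys
≼-length {xs = xs} (us , p) =
  subst (length xs ℕ.≤_) (sym (trans (↭-length p) (length-++ xs))) (ℕₚ.m≤m+n _ _)

All-≼ : {P : A → Set} → xs ≼ ys → All P ys → All P xs
All-≼ {xs = xs} (us , p) a = All.tabulate λ i → All.lookup a (∈-resp-↭ (↭-sym p) (∈-++⁺ˡ i))

filter-≼ : {P : A → Set} (P? : Decidable P) (xs : List A) → filter P? xs ≼ xs
filter-≼ P? [] = ≼-refl
filter-≼ P? (x ∷ xs) with P? x
... | yes p = ≼-∷ x (filter-≼ P? xs)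
... | no ¬p = ≼-trans (filter-≼ P? xs) (++-≼ʳ {xs = x ∷ []})

length-filter-∁ : {P : A → Set} (P? : Decidable P) (xs : List A) →
  length (filter P? xs) ℕ.+ length (filter (λ x → ¬? (P? x)) xs) ≡ length xs
length-filter-∁ P? [] = refl
length-filter-∁ P? (x ∷ xs) with P? x
... | yes p = cong suc (length-filter-∁ P? xs)
... | no ¬p = trans (ℕₚ.+-suc _ _) (cong suc (length-filter-∁ P? xs))

take-≼ : ∀ k → k ℕ.≤ length xs → ∃[ ys ] (ys ≼ xs × length ys ≡ k)
take-≼ {xs = xs} k k≤ = take k xs
  , (drop k xs , ↭-reflexive (sym (Listₚ.take++drop≡id k xs)))
  , trans (Listₚ.length-take k xs) (ℕₚ.m≤n⇒m⊓n≡m k≤)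

∈⇒↭∷ : ∀ {x : A} → x ∈ xs → ∃[ ys ] xs ↭ x ∷ ys
∈⇒↭∷ {x = x} i with ∈-∃++ i
... | ys , zs , refl = ys ++ zs , shift x ys zs

concatMap-↭ : (f : A → List B) → xs ↭ ys → concatMap f xs ↭ concatMap f ys
concatMap-↭ f refl = refl
concatMap-↭ f (prep x p) = ++⁺ˡ (f x) (concatMap-↭ f p)
concatMap-↭ f (swap x y p) = ↭-trans (shifts (f x) (f y)) (++⁺ˡ (f y) (++⁺ˡ (f x) (concatMap-↭ f p)))
concatMap-↭ f (_↭_.trans p q) = ↭-trans (concatMap-↭ f p) (concatMap-↭ f q)

concatMap-≼ : (f : A → List B) → xs ≼ ys → concatMap f xs ≼ concatMap f ys
concatMap-≼ {xs = xs} f (us , p) =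
  concatMap f us , ↭-trans (concatMap-↭ f p) (↭-reflexive (Listₚ.concatMap-++ f xs us))

-- Removing x from `ys` keeps the later elements, since their images under `f` differ from that of
-- x. With `f = id` this is the pigeonhole principle; with `f = class` it places representatives of
-- distinct classes.
unique-≼ : (f : A → B) → Unique (map f xs) → All (_∈ ys) xs → xs ≼ ys
unique-≼ {xs = []} {ys = ys} f u a = ys , refl
unique-≼ {xs = x ∷ xs} f (x∉ ∷ u) (i ∷ a) with ∈⇒↭∷ i
... | ys′ , p = ≼-trans (≼-∷ x (unique-≼ f u (rest x∉ a))) (↭⇒≼ (↭-sym p))
  where
  rest : ∀ {ws} → All (f x ≢_) (map f ws) → All (_∈ _) ws → All (_∈ ys′) ws
  rest {[]} [] [] = []
  rest {w ∷ ws} (n ∷ ns) (j ∷ js) with ∈-resp-↭ p j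
  ... | here refl = contradiction refl n
  ... | there k = k ∷ rest ns js

-- Along `ys`, each entry is charged either to `xs` and kept, or to the complement and dropped.
≼⇒⊆ : xs ≼ ys → ∃[ zs ] (zs ⊆ ys × xs ↭ zs)
≼⇒⊆ {xs = xs} {ys = ys} (us , p) = go ys xs us p
  where
  go : ∀ {A : Set} (ys xs us : List A) → ys ↭ xs ++ us → ∃[ zs ] (zs ⊆ ys × xs ↭ zs)
  go [] [] us p = [] , [] , refl
  go [] (x ∷ xs) us p with () ← ↭-length p
  go (y ∷ ys) xs us p with ∈-++⁻ xs (∈-resp-↭ p (here refl))
  ... | inj₁ i with ∈⇒↭∷ i
  ...   | xs′ , q with go ys xs′ us (drop-∷ (↭-trans p (++⁺ʳ us q)))
  ...     | zs , s , r = y ∷ zs , refl ∷ s , ↭-trans q (prep y r)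
  go (y ∷ ys) xs us p | inj₂ i with ∈⇒↭∷ i
  ...   | us′ , q with go ys xs us′ (drop-∷ (↭-trans p (↭-trans (++⁺ˡ xs q) (shift y xs us′))))
  ...     | zs , s , r = zs , y ∷ʳ s , r

-- Subset sums modulo a prime

Σℤ : List ℤ → ℤ
Σℤ = foldr _+_ 0ℤ

infix 4 _⇝_

-- The subset sums of a list. The derivation records which entries are summed, and the constructions
-- in `choose` and `split` recurse on it.
data _⇝_ : List ℤ → ℤ → Set where
  []   : [] ⇝ 0ℤ
  skip : fs ⇝ s → (a ∷ fs) ⇝ s
  pick : fs ⇝ s → (a ∷ fs) ⇝ a + s

infix 4 _≡_mod_

record _≡_mod_ (a b : ℤ) (n : ℕ) : Set where
  constructor congruent
  field ∣-difference : + n ∣ a - b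
open _≡_mod_ public

mod-refl : a ≡ a mod n
mod-refl {a} {n} = congruent (divides 0ℤ (trans (ℤₚ.+-inverseʳ a) (sym (ℤₚ.*-zeroˡ (+ n)))))

mod-sym : a ≡ b mod n → b ≡ a mod n
mod-sym {a} {b} {n} (congruent d) = congruent (subst (+ n ∣_) (lem a b) (∣m⇒∣-m d))
  where
  lem : ∀ a b → - (a - b) ≡ b - a
  lem = solve-∀

mod-trans : a ≡ b mod n → b ≡ c mod n → a ≡ c mod n
mod-trans {a} {b} {n} {c} (congruent d) (congruent e) =
    congruent (subst (+ n ∣_) (lem a b c) (∣m∣n⇒∣m+n d e))
  where
  lem : ∀ a b c → (a - b) + (b - c) ≡ a - c
  lem = solve-∀

mod-+ˡ : ∀ a → b ≡ c mod n → a + b ≡ a + c mod n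
mod-+ˡ {b} {c} {n} a (congruent d) = congruent (subst (+ n ∣_) (lem a b c) d)
  where
  lem : ∀ a b c → b - c ≡ (a + b) - (a + c)
  lem = solve-∀

mod? : ∀ n a b → Dec (a ≡ b mod n)
mod? n a b = map′ congruent ∣-difference (+ n ∣? (a - b))

mod-%ℕ : ∀ n .{{_ : ℕ.NonZero n}} a → a ≡ + (a %ℕ n) mod n
mod-%ℕ n a = congruent (divides (a /ℕ n)
  (trans (cong (_- + (a %ℕ n)) (a≡a%ℕn+[a/ℕn]*n a n)) (lem (+ (a %ℕ n)) (a /ℕ n * + n))))
  where
  lem : ∀ x y → (x + y) - x ≡ y
  lem = solve-∀

inverse : Prime p → ¬ (+ p ∣ a) → ∃[ u ] u * a ≡ 1ℤ mod p
inverse {p} {a} pr p∤a with coprime-Bézout coprime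
  where
  coprime : Coprime p ∣ a ∣
  coprime (d∣p , d∣a) with prime⇒irreducible pr d∣p
  ... | inj₁ d≡1 = d≡1
  ... | inj₂ refl = contradiction (∣ᵤ⇒∣ d∣a) p∤a
... | id = withSign (fromAbs id)
  where
  lemN : ∀ x y a p → + 1 + y * a ≡ x * p → (- y) * a - 1ℤ ≡ (- x) * p
  lemN x y a p e = trans (l1 y a) (trans (cong -_ e) (ℤₚ.neg-distribˡ-* x p))
    where
    l1 : ∀ y a → (- y) * a - 1ℤ ≡ - (1ℤ + y * a)
    l1 = solve-∀
  lemP : ∀ x y a p → + 1 + x * p ≡ y * a → y * a - 1ℤ ≡ x * p
  lemP x y a p e = trans (cong (_- 1ℤ) (sym e)) (l1 _)
    where
    l1 : ∀ z → (1ℤ + z) - 1ℤ ≡ z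
    l1 = solve-∀
  toℤ : ∀ x y z w → 1 ℕ.+ x ℕ.* y ≡ z ℕ.* w → + 1 + + x * + y ≡ + z * + w
  toℤ x y z w e = trans (cong (_+_ 1ℤ) (sym (ℤₚ.pos-* x y))) (trans (cong (λ k → + k) e) (ℤₚ.pos-* z w))
  fromAbs : Bézout.Identity 1 p ∣ a ∣ → ∃[ u ] u * (+ ∣ a ∣) ≡ 1ℤ mod p
  fromAbs (Bézout.+- x y e) = - (+ y) , congruent
      (divides (- (+ x)) (lemN (+ x) (+ y) _ _ (toℤ y ∣ a ∣ x p e)))
  fromAbs (Bézout.-+ x y e) = + y , congruent (divides (+ x) (lemP (+ x) (+ y) _ _ (toℤ x p y ∣ a ∣ e)))
  withSign : ∃[ u ] u * (+ ∣ a ∣) ≡ 1ℤ mod p → ∃[ u ] u * a ≡ 1ℤ mod p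
  withSign (u , d) with ℤₚ.+∣i∣≡i⊎+∣i∣≡-i a
  ... | inj₁ e = u , subst (λ z → u * z ≡ 1ℤ mod p) e d
  ... | inj₂ e = - u , subst (λ z → z ≡ 1ℤ mod p) (trans (cong (u *_) e) (l1 u a)) d
    where
    l1 : ∀ u a → u * (- a) ≡ (- u) * a
    l1 = solve-∀

prime-∣* : Prime p → + p ∣ a * b → (+ p ∣ a) ⊎ (+ p ∣ b)
prime-∣* {p} {a} {b} pr d with euclidsLemma ∣ a ∣ ∣ b ∣ pr (subst (p ℕ∣.∣_) (ℤₚ.abs-* a b) (∣⇒∣ᵤ d))
... | inj₁ e = inj₁ (∣ᵤ⇒∣ e)
... | inj₂ e = inj₂ (∣ᵤ⇒∣ e)

incongruent-length : ∀ n .{{_ : ℕ.NonZero n}} {L} →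
  AllPairs (λ a b → ¬ a ≡ b mod n) L → length L ℕ.≤ n
incongruent-length n {L} ap = subst₂ ℕ._≤_ (length-map (_%ℕ n) L) (Listₚ.length-upTo n)
  (≼-length (unique-≼ id (subst (AllPairs _≢_) (sym (Listₚ.map-id _)) uniq)
      (Allₚ.map⁺ (All.tabulate λ {x} _ → ∈-upTo⁺ (n%ℕd<d x n)))))
  where
  uniq : AllPairs _≢_ (map (_%ℕ n) L)
  uniq = AllPairsₚ.map⁺ (AllPairs.map (λ {x} {y} x≢y e → x≢y
    (mod-trans (mod-%ℕ n x) (subst (λ r → + r ≡ y mod n) (sym e) (mod-sym (mod-%ℕ n y))))) ap)

-- Only `unit` certifies an entry as prime to p, while `any` claims nothing about its entry; the
-- index is thus a lower bound for the number of units.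
data Units (p : ℕ) : ℕ → List ℤ → Set where
  []   : Units p 0 []
  any  : ∀ {k} → Units p k fs → Units p k (a ∷ fs)
  unit : ∀ {k} → ¬ (+ p ∣ a) → Units p k fs → Units p (suc k) (a ∷ fs)

module _ {p} (pr : Prime p) where
  private instance
    p≢0 = prime⇒nonZero pr

  -- A proper nonempty set of residues is not stable under translation by a unit.
  translate-escapes : ∀ {L : List ℤ} {x} → x ∈ L → ¬ (+ p ∣ a) → ∀ t →
    Any (_≡ t mod p) L ⊎ ∃[ y ] (y ∈ L × ¬ Any (_≡ a + y mod p) L)
  translate-escapes {a} {L} {x} x∈L p∤a t with inverse pr p∤a
  -- With u inverse to a, the progression x, x + a, x + 2a, ... reaches t after (t - x)u steps
  -- modulo p. Either it stays in the residues of `L` up to t, or it leaves them at some y.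
  ... | u , ua≡1 = walk (((t - x) * u) %ℕ p) x (lose x∈L mod-refl) (x+ja≡t _ (mod-%ℕ p ((t - x) * u)))
    where
    walk : ∀ j x → Any (_≡ x mod p) L → x + + j * a ≡ t mod p →
      Any (_≡ t mod p) L ⊎ ∃[ y ] (y ∈ L × ¬ Any (_≡ a + y mod p) L)
    walk zero x i e = inj₁ (Any.map (λ d → mod-trans d (subst (λ z → z ≡ t mod p) (l x a) e)) i)
      where
      l : ∀ x a → x + 0ℤ * a ≡ x
      l = solve-∀
    walk (suc j) x i e with find i
    ... | y , y∈ , y≡x with any? (λ z → mod? p z (a + y)) L
    ...   | no ¬i = inj₂ (y , y∈ , ¬i)
    ...   | yes i′ = walk j (a + x) (Any.map (λ d → mod-trans d (mod-+ˡ a y≡x)) i′)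
                      (subst (λ z → z ≡ t mod p)
                          (trans (cong (λ k → x + k * a) (ℤₚ.pos-+ 1 j)) (l x (+ j) a)) e)
      where
      l : ∀ x j a → x + (1ℤ + j) * a ≡ (a + x) + j * a
      l = solve-∀
    x+ja≡t : ∀ j → (t - x) * u ≡ + j mod p → x + + j * a ≡ t mod p
    x+ja≡t j d = congruent (subst (+ p ∣_) (l x t (+ j) u a)
      (∣m∣n⇒∣m+n (∣m⇒∣m*n (- a) (∣-difference d)) (∣n⇒∣m*n (t - x) (∣-difference ua≡1))))
      where
      l : ∀ x t j u a → ((t - x) * u - j) * (- a) + (t - x) * (u * a - 1ℤ) ≡ x + j * a - t
      l = solve-∀

  -- A special case of Cauchy-Davenport: a unit a enlarges the set A of residues attained to A ∪ (a
  -- + A), which has a new element unless A already contains t. Hence k units give k + 1 incongruent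
  -- sums.
  subset-sums-grow : ∀ {k fs} → Units p k fs → ∀ t →
    (∃[ s ] (fs ⇝ s × s ≡ t mod p)) ⊎
    (∃[ x ] ∃[ L ] (length L ≡ k × All (fs ⇝_) (x ∷ L)
                    × AllPairs (λ a b → ¬ a ≡ b mod p) (x ∷ L)))
  subset-sums-grow [] t = inj₂ (0ℤ , [] , refl , [] ∷ [] , [] ∷ [])
  subset-sums-grow (any us) t with subset-sums-grow us t
  ... | inj₁ (s , sub , e) = inj₁ (s , skip sub , e)
  ... | inj₂ (x , L , len , subs , ap) = inj₂ (x , L , len , All.map skip subs , ap)
  subset-sums-grow (unit {a = a} p∤a us) t with subset-sums-grow us t
  ... | inj₁ (s , sub , e) = inj₁ (s , skip sub , e)
  ... | inj₂ (x , L , len , subs , ap) = extend (translate-escapes (here refl) p∤a t)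
    where
    extend : Any (_≡ t mod p) (x ∷ L) ⊎ ∃[ y ] (y ∈ x ∷ L × ¬ Any (_≡ a + y mod p) (x ∷ L)) → _
    extend (inj₁ i) = let s , s∈ , e = find i in inj₁ (s , skip (All.lookup subs s∈) , e)
    extend (inj₂ (y , y∈ , esc)) =
      inj₂ (a + y , x ∷ L , cong suc len , pick (All.lookup subs y∈) ∷ All.map skip subs
           , All.map (λ ¬e e → ¬e (mod-sym e)) (Allₚ.¬Any⇒All¬ (x ∷ L) esc) ∷ ap)

  -- If t were missed, then t and the k + 1 ≥ p incongruent sums would be more than p pairwise
  -- incongruent integers.
  all-residues-are-subset-sums : ∀ {k fs} → Units p k fs → p ℕ.≤ suc k → ∀ t →
    ∃[ s ] (fs ⇝ s × s ≡ t mod p)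
  all-residues-are-subset-sums us p≤ t with subset-sums-grow us t
  ... | inj₁ r = r
  ... | inj₂ (x , L , len , subs , ap) with any? (λ s → mod? p s t) (x ∷ L)
  ...   | yes i = let s , s∈ , e = find i in s , All.lookup subs s∈ , e
  ...   | no ¬i = contradiction
    (incongruent-length p {t ∷ x ∷ L} (All.map (λ ¬e e → ¬e (mod-sym e)) (Allₚ.¬Any⇒All¬ (x ∷ L) ¬i) ∷ ap))
    (ℕₚ.<⇒≱ (s≤s (subst (λ k → p ℕ.≤ suc k) (sym len) p≤)))

∣⇒mod0 : + n ∣ a → a ≡ 0ℤ mod n
∣⇒mod0 {n} {a} d = congruent (subst (+ n ∣_) (sym (ℤₚ.+-identityʳ a)) d)

mod0⇒∣ : a ≡ 0ℤ mod n → + n ∣ a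
mod0⇒∣ {a} {n} (congruent d) = subst (+ n ∣_) (ℤₚ.+-identityʳ a) d

mod-+ : ∀ {a b c d} → a ≡ b mod n → c ≡ d mod n → a + c ≡ b + d mod n
mod-+ {n} {a} {b} {c} {d} (congruent x) (congruent y) =
  congruent (subst (+ n ∣_) (lem a b c d) (∣m∣n⇒∣m+n x y))
  where
  lem : ∀ a b c d → (a - b) + (c - d) ≡ (a + c) - (b + d)
  lem = solve-∀

-- Erdős–Ginzburg–Ziv

flatten : List (A × A) → List A
flatten = concatMap (λ (x , y) → x ∷ y ∷ [])

module _ {X : Set} (v : X → ℤ) where

  Σv : List X → ℤ
  Σv xs = Σℤ (map v xs)

  Σv-constant : ∀ {xs} → All (λ x → v x ≡ r mod n) xs → Σv xs ≡ + length xs * r mod n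
  Σv-constant {r} {n} [] = subst (λ z → 0ℤ ≡ z mod n) (sym (ℤₚ.*-zeroˡ r)) mod-refl
  Σv-constant {r} {n} {x ∷ xs} (e ∷ es) =
    subst (λ z → v x + Σv xs ≡ z mod n) (lem r (+ length xs)) (mod-+ e (Σv-constant es))
    where
    lem : ∀ r l → r + l * r ≡ (1ℤ + l) * r
    lem = solve-∀

  -- One element is taken from each pair: the first by default, the second where the difference is
  -- picked.
  choose : ∀ ps → map (λ (x , y) → v y - v x) ps ⇝ s →
    ∃[ U ] (U ≼ flatten ps × length U ≡ length ps × Σv U ≡ Σv (map proj₁ ps) + s)
  choose [] [] = [] , ≼-refl , refl , refl
  choose ((x , y) ∷ ps) (skip {s = s} sub) with choose ps sub
  ... | U , U≼ , len , e = x ∷ U , ≼-∷ x (≼-trans U≼ (++-≼ʳ {xs = y ∷ []})) , cong suc len ,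
        trans (cong (_+_ (v x)) e) (sym (ℤₚ.+-assoc (v x) _ s))
  choose ((x , y) ∷ ps) (pick {s = s} sub) with choose ps sub
  ... | U , U≼ , len , e = y ∷ U , ≼-trans (≼-∷ y U≼) (++-≼ʳ {xs = x ∷ []}) , cong suc len ,
        trans (cong (_+_ (v y)) e) (lem (v x) (v y) (Σv (map proj₁ ps)) s)
    where
    lem : ∀ x y t s → y + (t + s) ≡ (x + t) + ((y - x) + s)
    lem = solve-∀

  Incongruent : ℕ → X × X → Set
  Incongruent n (x , y) = ¬ v y ≡ v x mod n

  zip-incongruent : ∀ {E R} → length E ℕ.< length R →
    All (λ x → v x ≡ r mod n) E → All (λ x → ¬ v x ≡ r mod n) R →
    ∃[ ps ] ∃[ w ] (flatten ps ++ w ∷ [] ≼ E ++ R × length ps ≡ length E × All (Incongruent n) ps)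
  zip-incongruent {E = []} {R = w ∷ R} _ [] _ = [] , w , ++-≼ˡ , refl , []
  zip-incongruent {E = x ∷ E} {R = y ∷ R} (s≤s l) (x≡r ∷ es) (y≢r ∷ rs) with zip-incongruent l es rs
  ... | ps , w , sub , len , inc = (x , y) ∷ ps , w
    , ≼-∷ x (≼-trans (≼-∷ y sub) (↭⇒≼ (↭-sym (shift y E R))))
    , cong suc len , (λ y≡x → y≢r (mod-trans y≡x x≡r)) ∷ inc

  -- Incongruent pairs are split off greedily. When this stops at a set E of congruent elements,
  -- either E can be enlarged or its elements can be matched with elements outside its residue
  -- class.
  pairing : ∀ n k xs → suc (k ℕ.+ k) ℕ.≤ length xs →
    (∃[ ps ] ∃[ w ] (flatten ps ++ w ∷ [] ≼ xs × length ps ≡ k × All (Incongruent n) ps)) ⊎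
    (∃[ E ] ∃[ r ] (E ≼ xs × length E ≡ suc k × All (λ x → v x ≡ r mod n) E))
  pairing n zero (x ∷ xs) _ = inj₁ ([] , x , ++-≼ˡ , refl , [])
  pairing n (suc k) (x ∷ xs) (s≤s l) with any? (λ y → ¬? (mod? n (v y) (v x))) xs
  ... | no none = let E , E≼ , len = take-≼ {xs = xs} (suc k) (ℕₚ.m+n≤o⇒m≤o (suc k) l) in
    inj₂ (x ∷ E , v x , ≼-∷ x E≼ , cong suc len , mod-refl ∷
      All-≼ E≼ (All.map (λ {y} → decidable-stable (mod? n (v y) (v x))) (Allₚ.¬Any⇒All¬ xs none)))
  ... | yes some with find some
  ...   | y , y∈ , y≢x with ∈⇒↭∷ y∈
  ...     | ys , perm with pairing n k ys
      (ℕ.s≤s⁻¹ (subst₂ ℕ._≤_ (cong suc (ℕₚ.+-suc k k)) (↭-length perm) l))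
  ...       | inj₁ (ps , w , sub , len , inc) = inj₁ ((x , y) ∷ ps , w ,
                ≼-trans (≼-∷ x (≼-∷ y sub)) (↭⇒≼ (prep x (↭-sym perm))) , cong suc len , y≢x ∷ inc)
  ...       | inj₂ (E , r , (R , perm′) , len , cs) with any? (λ z → mod? n (v z) r) (x ∷ y ∷ R)
  ...         | yes i = let z , z∈ , z≡r = find i ; R′ , q = ∈⇒↭∷ z∈ in
    inj₂ (z ∷ E , r , (R′ , ↭-trans whole (↭-trans (++⁺ˡ E q) (shift z E R′))) , cong suc len , z≡r ∷ cs)
    where
    whole : x ∷ xs ↭ E ++ x ∷ y ∷ R
    whole = ↭-trans (prep x (↭-trans perm (prep y perm′))) (shifts (x ∷ y ∷ []) E)
  -- Everything outside E has another residue and outnumbers E, so the pairs are formed afresh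
  -- between E and its complement, with one element to spare.
  ...         | no none = let ps , w , sub , lenps , inc = zip-incongruent E<R cs (Allₚ.¬Any⇒All¬ (x ∷ y ∷ R) none) in
    inj₁ (ps , w , ≼-trans sub (↭⇒≼ (↭-sym whole)) , trans lenps len , inc)
    where
    whole : x ∷ xs ↭ E ++ x ∷ y ∷ R
    whole = ↭-trans (prep x (↭-trans perm (prep y perm′))) (shifts (x ∷ y ∷ []) E)
    E<R : length E ℕ.< length (x ∷ y ∷ R)
    E<R = ℕₚ.+-cancelˡ-≤ (length E) _ _
        (ℕₚ.≤-trans (ℕₚ.≤-reflexive (trans (cong (λ m → m ℕ.+ suc m) len) (ℕₚ.+-suc (suc k) (suc k))))
        (ℕₚ.≤-trans (s≤s l) (ℕₚ.≤-reflexive (trans (↭-length whole) (length-++ E)))))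

  -- k + 1 congruent values add up to zero modulo k + 1. Otherwise the k differences of the pairs
  -- are units, whose subset sums reach the residue that cancels the first members together with the
  -- spare element.
  erdős-ginzburg-ziv : ∀ {k} → Prime (suc k) → ∀ xs → suc (k ℕ.+ k) ℕ.≤ length xs →
    ∃[ U ] (U ≼ xs × length U ≡ suc k × + suc k ∣ Σv U)
  erdős-ginzburg-ziv {k} pr xs l with pairing (suc k) k xs l
  ... | inj₂ (E , r , E≼ , len , cs) = E , E≼ , len ,
    mod0⇒∣ (mod-trans (Σv-constant cs) (∣⇒mod0 (∣m⇒∣m*n r (subst (λ m → + suc k ∣ + m) (sym len) ∣-refl))))
  ... | inj₁ (ps , w , sub , len , inc) =
    let s , ss , e = all-residues-are-subset-sums pr (units ps inc) (ℕₚ.≤-reflexive (cong suc (sym len))) (- (Σv (map proj₁ ps) + v w))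
        U , U≼ , lenU , eU = choose ps ss
    in w ∷ U
     , ≼-trans (≼-trans (≼-∷ w U≼) (↭⇒≼ (++-comm (w ∷ []) (flatten ps)))) sub
     , cong suc (trans lenU len)
     , subst (+ suc k ∣_) (trans (lem (v w) (Σv (map proj₁ ps)) s) (cong (_+_ (v w)) (sym eU)))
         (∣-difference e)
    where
    lem : ∀ w t s → s - (- (t + w)) ≡ w + (t + s)
    lem = solve-∀
    units : ∀ ps → All (Incongruent (suc k)) ps → Units (suc k) (length ps) (map (λ (x , y) → v y - v x) ps)
    units [] [] = []
    units (_ ∷ ps) (i ∷ is) = unit (λ d → i (congruent d)) (units ps is)

-- Blocks with trivial product

-- The infinite dihedral group times C₂; (i , e , c) stands for xⁱ yᵉ zᶜ.
H : Set
H = ℤ × Bool × Bool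

private variable
  g h : H

ex : H → ℤ
ex (i , _ , _) = i

isReflection : H → Bool
isReflection (_ , e , _) = e

central : H → Bool
central (_ , _ , c) = c

signed : Bool → ℤ → ℤ
signed false i = i
signed true i = - i

infixl 7 _·_

_·_ : H → H → H
(i , e , c) · (j , f , d) = i + signed e j , e xor f , c xor d

ε : H
ε = 0ℤ , false , false

π : List H → H
π = foldr _·_ ε

≡-H : ∀ {i j : ℤ} {e f c d : Bool} → i ≡ j → e ≡ f → c ≡ d → (i , e , c) ≡ (j , f , d)
≡-H refl refl refl = refl

·-assoc : ∀ g h k → (g · h) · k ≡ g · (h · k)
·-assoc (i , e , c) (j , f , d) (k , e′ , c′) =
  ≡-H (lem e f) (Boolₚ.xor-assoc e f e′) (Boolₚ.xor-assoc c d c′)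
  where
  l1 : ∀ i j k → (i + - j) + - k ≡ i + - (j + k)
  l1 = solve-∀
  l2 : ∀ i j k → (i + - j) + k ≡ i + - (j + - k)
  l2 = solve-∀
  lem : ∀ e f → (i + signed e j) + signed (e xor f) k ≡ i + signed e (j + signed f k)
  lem false false = ℤₚ.+-assoc i j k
  lem false true = ℤₚ.+-assoc i j (- k)
  lem true false = l1 i j k
  lem true true = l2 i j k

·-identityˡ : ∀ g → ε · g ≡ g
·-identityˡ (i , e , c) = ≡-H (ℤₚ.+-identityˡ i) refl refl

π-++ : ∀ xs ys → π (xs ++ ys) ≡ π xs · π ys
π-++ [] ys = sym (·-identityˡ (π ys))
π-++ (x ∷ xs) ys = trans (cong (x ·_) (π-++ xs ys)) (sym (·-assoc x (π xs) (π ys)))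

Rotation : H → Set
Rotation g = isReflection g ≡ false

Reflection : H → Set
Reflection g = isReflection g ≡ true

ex-rotation : Rotation g → ∀ h → ex (g · h) ≡ ex g + ex h
ex-rotation refl h = refl

·-rotation : Rotation g → Rotation h → Rotation (g · h)
·-rotation refl refl = refl

-- The image in D_{2n} × C₂ is the identity.
record Trivial (n : ℕ) (g : H) : Set where
  constructor trivial
  field
    n∣ex : + n ∣ ex g
    rotation : Rotation g
    central-trivial : central g ≡ false
open Trivial

Trivial-ε : Trivial n ε
Trivial-ε = trivial (divides 0ℤ refl) refl refl

Trivial-· : Trivial n g → Trivial n h → Trivial n (g · h)
Trivial-· {n} {g} {h} (trivial d refl refl) (trivial e refl refl) = trivial (∣m∣n⇒∣m+n d e) refl refl

record Block (n : ℕ) : Set where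
  constructor block
  field
    elements : List H
    size : length elements ≡ n
    product-one : Trivial n (π elements)
open Block

-- Exponents are integers, so one sequence can be read modulo every n; this permits the passage from
-- n to a multiple of n.
HasBlock : ℕ → Set
HasBlock n = ∀ S → 2 ℕ.* n ℕ.+ 2 ℕ.≤ length S → Σ[ B ∈ Block n ] elements B ≼ S

module _ {n : ℕ} where

  -- The product of a block is x to the power qn. Quotients add when blocks are concatenated, so
  -- Erdős-Ginzburg-Ziv is applied to them.
  blockQuotient : Block n → ℤ
  blockQuotient B = quotient (n∣ex (product-one B))

  private
    els : List (Block n) → List H
    els = concatMap elements

  length-blocks : ∀ Bs → length (els Bs) ≡ n ℕ.* length Bs
  length-blocks [] = sym (ℕₚ.*-zeroʳ n)
  length-blocks (B ∷ Bs) = trans (length-++ (elements B))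
    (trans (cong₂ ℕ._+_ (size B) (length-blocks Bs)) (sym (ℕₚ.*-suc n (length Bs))))

  product-blocks : ∀ Bs → π (els Bs) ≡ (Σv blockQuotient Bs * + n , false , false)
  product-blocks [] = refl
  product-blocks (B ∷ Bs) with elements B | product-one B
  ... | T | trivial (divides q e) rot cen =
      trans (π-++ T (els Bs)) (trans (cong (π T ·_) (product-blocks Bs)) (lem (π T) e rot cen))
    where
    lem : ∀ g → ex g ≡ q * + n → Rotation g → central g ≡ false →
      g · (Σv blockQuotient Bs * + n , false , false) ≡ ((q + Σv blockQuotient Bs) * + n , false , false)
    lem _ refl refl refl = ≡-H (sym (ℤₚ.*-distribʳ-+ (+ n) q _)) refl refl

  combine-blocks : ∀ {k} → Prime (suc k) → ∀ Bs → suc (k ℕ.+ k) ℕ.≤ length Bs →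
    Σ[ B ∈ Block (n ℕ.* suc k) ] elements B ≼ els Bs
  combine-blocks {k} pr Bs l with erdős-ginzburg-ziv blockQuotient pr Bs l
  ... | U , U≼ , len , divides q e = block (els U) (trans (length-blocks U) (cong (n ℕ.*_) len))
      (subst (Trivial _) (sym (product-blocks U)) (trivial (divides q eq) refl refl))
    , concatMap-≼ elements U≼
    where
    l1 : ∀ q k n → (q * k) * n ≡ q * (n * k)
    l1 = solve-∀
    eq : Σv blockQuotient U * + n ≡ q * + (n ℕ.* suc k)
    eq = trans (cong (_* + n) e) (trans (l1 q (+ suc k) (+ n)) (cong (q *_) (sym (ℤₚ.pos-* n (suc k)))))

  extract-blocks : HasBlock n → ∀ j S → n ℕ.* j ℕ.+ (2 ℕ.* n ℕ.+ 2) ℕ.≤ length S →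
    ∃[ Bs ] (els Bs ≼ S × length Bs ≡ suc j)
  extract-blocks hasBlock zero S l = let B , B≼ = hasBlock S (ℕₚ.m+n≤o⇒n≤o (n ℕ.* 0) l) in
    B ∷ [] , subst (_≼ S) (sym (Listₚ.++-identityʳ (elements B))) B≼ , refl
  extract-blocks hasBlock (suc j) S l with hasBlock S (ℕₚ.m+n≤o⇒n≤o (n ℕ.* suc j) l)
  ... | B , R , S↭B++R with extract-blocks hasBlock j R (ℕₚ.+-cancelˡ-≤ n _ _ (begin
      n ℕ.+ (n ℕ.* j ℕ.+ (2 ℕ.* n ℕ.+ 2)) ≡⟨ ℕₚ.+-assoc n (n ℕ.* j) _ ⟨
      n ℕ.+ n ℕ.* j ℕ.+ (2 ℕ.* n ℕ.+ 2) ≡⟨ cong (ℕ._+ (2 ℕ.* n ℕ.+ 2)) (ℕₚ.*-suc n j) ⟨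
      n ℕ.* suc j ℕ.+ (2 ℕ.* n ℕ.+ 2) ≤⟨ l ⟩
      length S ≡⟨ ↭-length S↭B++R ⟩
      length (elements B ++ R) ≡⟨ length-++ (elements B) ⟩
      length (elements B) ℕ.+ length R ≡⟨ cong (ℕ._+ length R) (size B) ⟩
      n ℕ.+ length R ∎))
    where open ℕₚ.≤-Reasoning
  ...   | Bs , Bs≼ , len = B ∷ Bs , ≼-trans (≼-++ ≼-refl Bs≼) (↭⇒≼ (↭-sym S↭B++R)) , cong suc len

  hasBlock-* : ∀ {k} → Prime (suc k) → HasBlock n → HasBlock (n ℕ.* suc k)
  -- Splitting off 2k blocks of length n leaves at least 2n + 2 elements, enough for one more: 2(k +
  -- 1) - 1 blocks in all.
  hasBlock-* {k} pr hasBlock S l with extract-blocks hasBlock (k ℕ.+ k) S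
      (subst (ℕ._≤ length S) (lem n k) l)
    where
    lem : ∀ n k → 2 ℕ.* (n ℕ.* suc k) ℕ.+ 2 ≡ n ℕ.* (k ℕ.+ k) ℕ.+ (2 ℕ.* n ℕ.+ 2)
    lem = ℕSolver.solve-∀
  ... | Bs , Bs≼ , len = let B , B≼ = combine-blocks pr Bs (ℕₚ.≤-reflexive (sym len)) in B , ≼-trans B≼ Bs≼

-- Parity of integers

odd : ℕ → Bool
odd zero = false
odd (suc n) = not (odd n)

parity : ℤ → Bool
parity i = odd ∣ i ∣

parity-suc : ∀ i → parity (1ℤ + i) ≡ not (parity i)
parity-suc (+ n) = refl
parity-suc -[1+ zero ] = refl
parity-suc -[1+ suc n ] = sym (Boolₚ.not-involutive (odd (suc n)))

parity-neg : ∀ i → parity (- i) ≡ parity i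
parity-neg i = cong odd (ℤₚ.∣-i∣≡∣i∣ i)

parity-+ : ∀ i j → parity (i + j) ≡ parity i xor parity j
parity-+ (+ n) j = go n
  where
  not-xor : ∀ b c → not (b xor c) ≡ not b xor c
  not-xor false c = refl
  not-xor true c = Boolₚ.not-involutive c
  go : ∀ n → parity (+ n + j) ≡ odd n xor parity j
  go zero = cong parity (ℤₚ.+-identityˡ j)
  go (suc n) = trans (cong parity (ℤₚ.+-assoc 1ℤ (+ n) j))
    (trans (parity-suc (+ n + j)) (trans (cong not (go n)) (not-xor (odd n) (parity j))))
parity-+ i@(-[1+ n ]) j = trans (cong parity (lem (+ suc n) j))
  (trans (parity-neg (+ suc n - j))
      (trans (parity-+ (+ suc n) (- j)) (cong (odd (suc n) xor_) (parity-neg j))))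
  where
  lem : ∀ m j → - m + j ≡ - (m - j)
  lem = solve-∀

even⇒2∣ : ∀ i → parity i ≡ false → + 2 ∣ i
even⇒2∣ i e = ∣ᵤ⇒∣ (go ∣ i ∣ e)
  where
  go : ∀ n → odd n ≡ false → 2 ℕ∣.∣ n
  go zero _ = 2 ℕ∣.∣0
  go (suc zero) ()
  go (suc (suc n)) e = ℕ∣.∣m∣n⇒∣m+n ℕ∣.∣-refl (go n (trans (sym (Boolₚ.not-involutive (odd n))) e))

-- Classes modulo ⟨x²⟩

-- The quotient by ⟨x²⟩, an elementary abelian group of order 8.
Class : Set
Class = Bool × Bool × Bool

class : H → Class
class (i , e , c) = parity i , e , c

infixr 6 _⊕_

_⊕_ : Class → Class → Class
(a , b , c) ⊕ (a′ , b′ , c′) = a xor a′ , b xor b′ , c xor c′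

0ᶜ : Class
0ᶜ = false , false , false

≡-Class : ∀ {a b c a′ b′ c′ : Bool} → a ≡ a′ → b ≡ b′ → c ≡ c′ → (a , b , c) ≡ (a′ , b′ , c′)
≡-Class refl refl refl = refl

⊕-assoc : ∀ x y z → (x ⊕ y) ⊕ z ≡ x ⊕ (y ⊕ z)
⊕-assoc (a , b , c) (a′ , b′ , c′) (a″ , b″ , c″) =
  ≡-Class (Boolₚ.xor-assoc a a′ a″) (Boolₚ.xor-assoc b b′ b″) (Boolₚ.xor-assoc c c′ c″)

⊕-comm : ∀ x y → x ⊕ y ≡ y ⊕ x
⊕-comm (a , b , c) (a′ , b′ , c′) =
  ≡-Class (Boolₚ.xor-comm a a′) (Boolₚ.xor-comm b b′) (Boolₚ.xor-comm c c′)

⊕-self : ∀ x → x ⊕ x ≡ 0ᶜ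
⊕-self (a , b , c) = ≡-Class (Boolₚ.xor-same a) (Boolₚ.xor-same b) (Boolₚ.xor-same c)

total : List H → Class
total = foldr (λ g → class g ⊕_) 0ᶜ

-- A reflection negates the exponent to its right, which leaves the parity unchanged.
class-· : ∀ g h → class (g · h) ≡ class g ⊕ class h
class-· (i , e , c) (j , f , d) = ≡-Class
  (trans (parity-+ i (signed e j)) (cong (parity i xor_) (lem e))) refl refl
  where
  lem : ∀ e → parity (signed e j) ≡ parity j
  lem false = refl
  lem true = parity-neg j

class-π : ∀ xs → class (π xs) ≡ total xs
class-π [] = refl
class-π (x ∷ xs) = trans (class-· x (π xs)) (cong (class x ⊕_) (class-π xs))

total-++ : ∀ xs ys → total (xs ++ ys) ≡ total xs ⊕ total ys
total-++ [] ys = refl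
total-++ (x ∷ xs) ys = trans (cong (class x ⊕_) (total-++ xs ys))
    (sym (⊕-assoc (class x) (total xs) (total ys)))

total-↭ : ∀ {xs ys} → xs ↭ ys → total xs ≡ total ys
total-↭ refl = refl
total-↭ (prep x p) = cong (class x ⊕_) (total-↭ p)
total-↭ (swap x y p) = trans (sym (⊕-assoc (class x) (class y) _))
  (trans (cong₂ _⊕_ (⊕-comm (class x) (class y)) (total-↭ p)) (⊕-assoc (class y) (class x) _))
total-↭ (_↭_.trans p q) = trans (total-↭ p) (total-↭ q)

class0⇒trivial : ∀ g → class g ≡ 0ᶜ → Trivial 2 g
class0⇒trivial (i , e , c) eq = trivial (even⇒2∣ i (cong proj₁ eq)) (cong (proj₁ ∘ proj₂) eq)
    (cong (proj₂ ∘ proj₂) eq)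

-- Choosing signs

-- Blocks placed between the two reflections contribute with inverted exponent.
module _ {b b′ : H} (refl-b : Reflection b) (refl-b′ : Reflection b′) where

  exponents : List (List H) → List ℤ
  exponents = map (ex ∘ π)

  -- `skip` sends a word to U and `pick` sends it to V. Words are moved whole, and as their products
  -- are rotations the exponents add.
  split : ∀ {ws s} → All (Rotation ∘ π) ws → exponents ws ⇝ s →
    ∃[ U ] ∃[ V ] (U ++ V ↭ concat ws × Rotation (π U) × Rotation (π V)
                   × ex (π U) + s ≡ Σℤ (exponents ws) × ex (π V) ≡ s)
  split {[]} [] [] = [] , [] , refl , refl , refl , refl , refl
  split {w ∷ ws} (rot ∷ rots) (skip {s = s} sub) with split rots sub
  ... | U , V , perm , rotU , rotV , eU , eV = w ++ U , V
    , ↭-trans (↭-reflexive (Listₚ.++-assoc w U V)) (++⁺ˡ w perm)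
    , subst Rotation (sym (π-++ w U)) (·-rotation {π w} {π U} rot rotU)
    , rotV
    , trans (cong (λ g → ex g + s) (π-++ w U)) (trans (cong (_+ s) (ex-rotation {π w} rot (π U)))
        (trans (ℤₚ.+-assoc (ex (π w)) (ex (π U)) s) (cong (_+_ (ex (π w))) eU)))
    , eV
  split {w ∷ ws} (rot ∷ rots) (pick {s = s} sub) with split rots sub
  ... | U , V , perm , rotU , rotV , eU , eV = U , w ++ V
    , ↭-trans (shifts U w) (++⁺ˡ w perm)
    , rotU
    , subst Rotation (sym (π-++ w V)) (·-rotation {π w} {π V} rot rotV)
    , trans (lem (ex (π U)) (ex (π w)) s) (cong (_+_ (ex (π w))) eU)
    , trans (cong ex (π-++ w V)) (trans (ex-rotation {π w} rot (π V)) (cong (_+_ (ex (π w))) eV))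
    where
    lem : ∀ u w s → u + (w + s) ≡ w + (u + s)
    lem = solve-∀

  -- The reflections are arguments here, shadowing those of the module, so that the formula also
  -- applies with the two exchanged.
  sandwich : ∀ U b V b′ → Reflection b → Rotation (π U) → Rotation (π V) →
    ex (π (U ++ b ∷ V ++ b′ ∷ [])) ≡ ex (π U) + (ex b - (ex (π V) + ex b′))
  sandwich U b@(j , true , d) V b′@(k , e , _) refl rotU rotV = trans (cong ex (π-++ U (b ∷ V ++ b′ ∷ [])))
    (trans (ex-rotation {π U} rotU (π (b ∷ V ++ b′ ∷ []))) (cong (λ z → ex (π U) + (j - z))
      (trans (cong ex (π-++ V (b′ ∷ []))) (trans (ex-rotation {π V} rotV (π (b′ ∷ [])))
        (cong (_+_ (ex (π V))) (lem e))))))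
    where
    lem : ∀ e → k + signed e 0ℤ ≡ k
    lem false = ℤₚ.+-identityʳ k
    lem true = ℤₚ.+-identityʳ k

  -- The product U b V b′ has exponent U + b - V - b′. Moving a word from U to V subtracts twice its
  -- exponent, and exchanging b with b′ subtracts 2(b - b′); the first entry of the list stands for
  -- this exchange.
  signed-sum : ∀ {ws s} → All (Rotation ∘ π) ws → (ex b - ex b′ ∷ exponents ws) ⇝ s →
    ∃[ T ] (T ↭ b ∷ b′ ∷ concat ws × ex (π T) ≡ (ex b - ex b′ + Σℤ (exponents ws)) - + 2 * s)
  signed-sum rots (skip {s = s} sub) with split rots sub
  ... | U , V , perm , rotU , rotV , eU , eV = U ++ b ∷ V ++ b′ ∷ []
    , ↭-trans (shift b U (V ++ b′ ∷ []))
        (prep b (↭-trans (↭-trans (↭-reflexive (sym (Listₚ.++-assoc U V _))) (++-comm (U ++ V) (b′ ∷ [])))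
        (prep b′ perm)))
    , trans (sandwich U b V b′ refl-b rotU rotV) (trans (cong (λ v → ex (π U) + (ex b - (v + ex b′))) eV)
       (trans (lem (ex (π U)) (ex b) (ex b′) s) (cong (λ m → (ex b - ex b′ + m) - + 2 * s) eU)))
    where
    lem : ∀ u b b′ s → u + (b - (s + b′)) ≡ (b - b′ + (u + s)) - + 2 * s
    lem = solve-∀
  signed-sum rots (pick {s = s} sub) with split rots sub
  ... | U , V , perm , rotU , rotV , eU , eV = U ++ b′ ∷ V ++ b ∷ []
    , ↭-trans (shift b′ U (V ++ b ∷ []))
        (↭-trans
        (prep b′
        (↭-trans (↭-trans (↭-reflexive (sym (Listₚ.++-assoc U V _))) (++-comm (U ++ V) (b ∷ [])))
        (prep b perm))) (swap b′ b refl))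
    , trans (sandwich U b′ V b refl-b′ rotU rotV) (trans (cong (λ v → ex (π U) + (ex b′ - (v + ex b))) eV)
       (trans (lem (ex (π U)) (ex b) (ex b′) s)
           (cong (λ m → (ex b - ex b′ + m) - + 2 * (ex b - ex b′ + s)) eU)))
    where
    lem : ∀ u b b′ s → u + (b′ - (s + b)) ≡ (b - b′ + (u + s)) - + 2 * (b - b′ + s)
    lem = solve-∀

  -- Total class zero makes every arrangement trivial modulo 2; in particular the exponent without
  -- sign changes is some 2h. A subset sum s ≡ h modulo p changes it to 2(h - s), a multiple of 2p.
  trivial-arrangement : Prime p → ∀ {ws k} → All (Rotation ∘ π) ws → total (b ∷ b′ ∷ concat ws) ≡ 0ᶜ →
    Units p k (ex b - ex b′ ∷ exponents ws) → p ℕ.≤ suc k →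
    ∃[ T ] (T ↭ b ∷ b′ ∷ concat ws × Trivial (2 ℕ.* p) (π T))
  trivial-arrangement {p} pr {ws} rots tot us p≤ = finish (even (signed-sum rots (none _)))
    where
    none : ∀ fs → fs ⇝ 0ℤ
    none [] = []
    none (f ∷ fs) = skip (none fs)
    E = ex b - ex b′ + Σℤ (exponents ws)
    parityT : ∀ {T} → T ↭ b ∷ b′ ∷ concat ws → Trivial 2 (π T)
    parityT {T} perm = class0⇒trivial (π T) (trans (class-π T) (trans (total-↭ perm) tot))
    even : ∃[ T ] (T ↭ b ∷ b′ ∷ concat ws × ex (π T) ≡ E - + 2 * 0ℤ) → ∃[ h ] E ≡ h * + 2
    even (T , perm , e) with n∣ex (parityT perm)
    ... | divides h eq = h , trans (trans (sym (ℤₚ.+-identityʳ E)) (sym e)) eq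
    finish : ∃[ h ] E ≡ h * + 2 → ∃[ T ] (T ↭ b ∷ b′ ∷ concat ws × Trivial (2 ℕ.* p) (π T))
    finish (h , E≡) with all-residues-are-subset-sums pr us p≤ h
    ... | s , sub , congruent (divides q e) with signed-sum rots sub
    ...   | T , perm , eT = T , perm , trivial (divides (- q) eq) (rotation (parityT perm))
        (central-trivial (parityT perm))
      where
      l1 : ∀ h s → h * + 2 - + 2 * s ≡ (- + 2) * (s - h)
      l1 = solve-∀
      l2 : ∀ q p → (- + 2) * (q * p) ≡ - q * (+ 2 * p)
      l2 = solve-∀
      eq : ex (π T) ≡ - q * + (2 ℕ.* p)
      eq = trans eT (trans (cong (_- + 2 * s) E≡) (trans (l1 h s) (trans (cong (_*_ (- + 2)) e)
        (trans (l2 q (+ p)) (cong (_*_ (- q)) (sym (ℤₚ.pos-* 2 p)))))))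

-- Pairs and leftover classes

_≟ᶜ_ : DecidableEquality Class
_≟ᶜ_ = ≡-dec Boolₚ._≟_ (≡-dec Boolₚ._≟_ Boolₚ._≟_)

record Pair : Set where
  constructor pair
  field
    left right : H
    same-class : class left ≡ class right

  members : List H
  members = left ∷ right ∷ []
open Pair

total-members : ∀ P → total (members P) ≡ 0ᶜ
total-members (pair g h e) = trans (cong (λ c → c ⊕ class h ⊕ 0ᶜ) e)
  (trans (sym (⊕-assoc (class h) (class h) 0ᶜ)) (cong (_⊕ 0ᶜ) (⊕-self (class h))))

members-trivial : ∀ P → Trivial 2 (π (members P))
members-trivial P = class0⇒trivial _ (trans (class-π (members P)) (total-members P))

pairBlock : Pair → Block 2
pairBlock P = block (members P) refl (members-trivial P)

allMembers : List Pair → List H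
allMembers = concatMap members

total-allMembers : ∀ Ps → total (allMembers Ps) ≡ 0ᶜ
total-allMembers [] = refl
total-allMembers (P ∷ Ps) = trans (total-++ (members P) (allMembers Ps))
    (cong₂ _⊕_ (total-members P) (total-allMembers Ps))

length-allMembers : ∀ Ps → length (allMembers Ps) ≡ length Ps ℕ.+ length Ps
length-allMembers [] = refl
length-allMembers (P ∷ Ps) = cong suc
    (trans (cong suc (length-allMembers Ps)) (sym (ℕₚ.+-suc (length Ps) (length Ps))))

pair-up : ∀ S → ∃[ Ps ] ∃[ L ] (S ↭ allMembers Ps ++ L × Unique (map class L))
pair-up [] = [] , [] , refl , []
pair-up (x ∷ S) with pair-up S
... | Ps , L , perm , u with any? (λ y → class y ≟ᶜ class x) L
...   | no ¬i = Ps , x ∷ L , ↭-trans (prep x perm) (↭-sym (shift x (allMembers Ps) L))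
              , Allₚ.map⁺ (All.map (λ ne e → ne (sym e)) (Allₚ.¬Any⇒All¬ L ¬i)) ∷ u
...   | yes i with find i
...     | y , y∈ , e with ∈⇒↭∷ y∈
...       | L′ , q = pair x y (sym e) ∷ Ps , L′
            , prep x (↭-trans perm (↭-trans (++⁺ˡ (allMembers Ps) q) (shift y (allMembers Ps) L′)))
            , AllPairs.tail (Unique-resp-↭ (setoid Class) (↭⇒↭ₛ (map⁺ class q)) u)

-- Unavoidable families of classes

subsequences : List A → List (List A)
subsequences [] = [] ∷ []
subsequences (x ∷ xs) = map (x ∷_) (subsequences xs) ++ subsequences xs

filter∈subsequences : {P : A → Set} (P? : Decidable P) (xs : List A) → filter P? xs ∈ subsequences xs
filter∈subsequences P? [] = here refl
filter∈subsequences P? (x ∷ xs) with P? x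
... | yes _ = ∈-++⁺ˡ (∈-map⁺ (x ∷_) (filter∈subsequences P? xs))
... | no _ = ∈-++⁺ʳ _ (filter∈subsequences P? xs)

bools : List Bool
bools = false ∷ true ∷ []

classes : List Class
classes = concatMap (λ a → concatMap (λ b → map (λ c → a , b , c) bools) bools) bools

∈-bools : ∀ b → b ∈ bools
∈-bools false = here refl
∈-bools true = there (here refl)

∈-classes : ∀ c → c ∈ classes
∈-classes (a , b , c) = All.lookup (All.lookup (All.lookup check (∈-bools a)) (∈-bools b)) (∈-bools c)
  where
  open DecMembership _≟ᶜ_ using (_∈?_)
  check : All (λ a → All (λ b → All (λ c → (a , b , c) ∈ classes) bools) bools) bools
  check = from-yes (all? (λ a → all? (λ b → all? (λ c → (a , b , c) ∈? classes) bools) bools) bools)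

open DecMembership _≟ᶜ_ using (_∈?_)

Meets : List (List Class) → List Class → Set
Meets blocks cs = Any (All (_∈ cs)) blocks

meets? : ∀ blocks cs → Dec (Meets blocks cs)
meets? blocks cs = any? (all? (_∈? cs)) blocks

-- A statement about the 256 subsets of the eight classes, hence decidable by evaluation.
-- `meets-unavoidable` transfers it to any list of distinct classes by listing these in the order of
-- `classes`.
Unavoidable : List (List Class) → Set
Unavoidable blocks = All (λ cs → Meets blocks cs ⊎ length cs ℕ.≤ 5) (subsequences classes)

unavoidable? : ∀ blocks → Dec (Unavoidable blocks)
unavoidable? blocks = all? (λ cs → meets? blocks cs ⊎-dec (length cs ℕ.≤? 5)) (subsequences classes)

meets-unavoidable : ∀ {blocks} → Unavoidable blocks → ∀ {cs} → Unique cs → 6 ℕ.≤ length cs → Meets blocks cs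
meets-unavoidable un {cs} u l with All.lookup un (filter∈subsequences (_∈? cs) classes)
... | inj₁ i = Any.map (All.map (λ c∈ → proj₂ (∈-filter⁻ (_∈? cs) c∈))) i
... | inj₂ small = contradiction
    (ℕₚ.≤-trans l (≼-length (unique-≼ id (subst Unique (sym (Listₚ.map-id cs)) u)
        (All.tabulate λ {c} c∈ → ∈-filter⁺ (_∈? cs) (∈-classes c) c∈)))) (ℕₚ.<⇒≱ (s≤s small))

realise-classes : ∀ {L cs} → All (_∈ map class L) cs → ∃[ gs ] (map class gs ≡ cs × All (_∈ L) gs)
realise-classes [] = [] , refl , []
realise-classes (i ∷ is) with ∈-map⁻ class i | realise-classes is
... | g , g∈ , e | gs , es , gs∈ = g ∷ gs , cong₂ _∷_ (sym e) es , g∈ ∷ gs∈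

find-block : ∀ {blocks} {P : List Class → Set} → Unavoidable blocks → All P blocks →
    (∀ {cs} → P cs → Unique cs) →
  ∀ {L} → Unique (map class L) → 6 ℕ.≤ length L → ∃[ gs ] (P (map class gs) × gs ≼ L)
find-block {blocks} {P} un allP uniq {L} u l with find
    (meets-unavoidable un u (subst (6 ℕ.≤_) (sym (length-map class L)) l))
... | cs , cs∈ , is with realise-classes is
...   | gs , refl , gs∈ = gs , All.lookup allP cs∈ , unique-≼ class (uniq (All.lookup allP cs∈)) gs∈

reflectionᶜ : Class → Bool
reflectionᶜ (_ , e , _) = e

⨁ : List Class → Class
⨁ = foldr _⊕_ 0ᶜ

-- In an elementary abelian 2-group these are exactly the quadruples of sum zero, with d the common
-- difference.
parallelograms : List (List Class)
parallelograms = concatMap (λ c → concatMap (λ d → map (λ r → c ∷ c ⊕ d ∷ r ∷ r ⊕ d ∷ []) classes) classes)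
    classes

Mixed : List Class → Set
Mixed cs@(c₁ ∷ c₂ ∷ c₃ ∷ c₄ ∷ []) = Unique cs × ⨁ cs ≡ 0ᶜ × reflectionᶜ c₁ ≡ false × reflectionᶜ c₂ ≡ false
  × reflectionᶜ c₃ ≡ true × reflectionᶜ c₄ ≡ true
Mixed _ = ⊥

mixed? : Decidable Mixed
mixed? [] = no λ ()
mixed? (_ ∷ []) = no λ ()
mixed? (_ ∷ _ ∷ []) = no λ ()
mixed? (_ ∷ _ ∷ _ ∷ []) = no λ ()
mixed? (_ ∷ _ ∷ _ ∷ _ ∷ _ ∷ _) = no λ ()
mixed? cs@(c₁ ∷ c₂ ∷ c₃ ∷ c₄ ∷ []) = DecUnique.unique? _≟ᶜ_ cs ×-dec (⨁ cs ≟ᶜ 0ᶜ)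
  ×-dec (reflectionᶜ c₁ Boolₚ.≟ false) ×-dec (reflectionᶜ c₂ Boolₚ.≟ false)
  ×-dec (reflectionᶜ c₃ Boolₚ.≟ true) ×-dec (reflectionᶜ c₄ Boolₚ.≟ true)

mixedBlocks : List (List Class)
mixedBlocks = filter mixed? parallelograms

abstract
  -- Rotations and reflections have four classes each. Among six classes there are at least two of
  -- each kind and at least three of one kind; those three realise all nonzero differences, in
  -- particular one realised by the other kind.
  mixed-unavoidable : Unavoidable mixedBlocks
  mixed-unavoidable = from-yes (unavoidable? mixedBlocks)

-- Inverting one suitable element changes the exponent of such a product by 2 modulo 4.
Alternating : List Class → Set
Alternating cs@(c₁ ∷ c₂ ∷ c₃ ∷ c₄ ∷ []) = Unique cs × ⨁ cs ≡ 0ᶜ × reflectionᶜ c₁ ≡ reflectionᶜ c₂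
  × reflectionᶜ c₃ ≡ true × reflectionᶜ c₄ ≡ true
  × (proj₁ c₃ xor proj₁ c₄ ≡ true ⊎ (reflectionᶜ c₁ ≡ false × proj₁ c₁ ≡ true))
Alternating _ = ⊥

alternating? : Decidable Alternating
alternating? [] = no λ ()
alternating? (_ ∷ []) = no λ ()
alternating? (_ ∷ _ ∷ []) = no λ ()
alternating? (_ ∷ _ ∷ _ ∷ []) = no λ ()
alternating? (_ ∷ _ ∷ _ ∷ _ ∷ _ ∷ _) = no λ ()
alternating? cs@(c₁ ∷ c₂ ∷ c₃ ∷ c₄ ∷ []) = DecUnique.unique? _≟ᶜ_ cs ×-dec (⨁ cs ≟ᶜ 0ᶜ)
  ×-dec (reflectionᶜ c₁ Boolₚ.≟ reflectionᶜ c₂)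
  ×-dec (reflectionᶜ c₃ Boolₚ.≟ true) ×-dec (reflectionᶜ c₄ Boolₚ.≟ true)
  ×-dec ((proj₁ c₃ xor proj₁ c₄ Boolₚ.≟ true) ⊎-dec
      ((reflectionᶜ c₁ Boolₚ.≟ false) ×-dec (proj₁ c₁ Boolₚ.≟ true)))

alternatingBlocks : List (List Class)
alternatingBlocks = filter alternating? parallelograms

abstract
  -- With four reflection classes these serve alone. With three of each kind, two reflections of
  -- different parity have the same difference as two rotations. With four rotation classes and two
  -- reflections of equal parity, the two odd rotations complete the quadruple.
  alternating-unavoidable : Unavoidable alternatingBlocks
  alternating-unavoidable = from-yes (unavoidable? alternatingBlocks)

-- Each pair is a block of length 2, so 2k + 1 pairs yield k + 1 whose product is trivial. With at
-- most 2k pairs, at least 6 of the 4k + 6 elements are left over; they have distinct classes, so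
-- there are at most 8 of them and at least 2k - 1 pairs.
pairs-or-classes : ∀ {k} → Prime (suc k) → ∀ S → 2 ℕ.* (2 ℕ.* suc k) ℕ.+ 2 ℕ.≤ length S →
  (Σ[ B ∈ Block (2 ℕ.* suc k) ] elements B ≼ S) ⊎
  (∃[ Ps ] ∃[ L ] (allMembers Ps ++ L ≼ S × Unique (map class L) × 6 ℕ.≤ length L × k ℕ.+ k ℕ.≤ suc
      (length Ps)))
pairs-or-classes {k} pr S l with pair-up S
... | Ps , L , perm , u with suc (k ℕ.+ k) ℕ.≤? length Ps
...   | yes k≤ = let B , B≼ = combine-blocks pr (map pairBlock Ps) (subst (suc (k ℕ.+ k) ℕ.≤_) (sym (length-map pairBlock Ps)) k≤) in
    inj₁ (B , ≼-trans (subst (elements B ≼_) (Listₚ.concatMap-map elements pairBlock Ps) B≼)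
                      (≼-trans ++-≼ˡ (↭⇒≼ (↭-sym perm))))
...   | no k≰ = inj₂ (Ps , L , ↭⇒≼ (↭-sym perm) , u , six , many)
  where
  open ℕₚ.≤-Reasoning
  count : 2 ℕ.* (2 ℕ.* suc k) ℕ.+ 2 ℕ.≤ length Ps ℕ.+ length Ps ℕ.+ length L
  count = ℕₚ.≤-trans l
      (ℕₚ.≤-reflexive
      (trans (↭-length perm)
      (trans (length-++ (allMembers Ps)) (cong (ℕ._+ length L) (length-allMembers Ps)))))
  few : length Ps ℕ.≤ k ℕ.+ k
  few = ℕ.s≤s⁻¹ (ℕₚ.≰⇒> k≰)
  eight : length L ℕ.≤ 8
  eight = subst (ℕ._≤ 8) (length-map class L) (≼-length (unique-≼ {ys = classes} id
    (subst Unique (sym (Listₚ.map-id (map class L))) u) (All.tabulate λ {c} _ → ∈-classes c)))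
  six : 6 ℕ.≤ length L
  six = ℕₚ.+-cancelˡ-≤ (k ℕ.+ k ℕ.+ (k ℕ.+ k)) 6 (length L) (begin
    k ℕ.+ k ℕ.+ (k ℕ.+ k) ℕ.+ 6 ≡⟨ lem k ⟩
    2 ℕ.* (2 ℕ.* suc k) ℕ.+ 2 ≤⟨ count ⟩
    length Ps ℕ.+ length Ps ℕ.+ length L ≤⟨ ℕₚ.+-monoˡ-≤ (length L) (ℕₚ.+-mono-≤ few few) ⟩
    k ℕ.+ k ℕ.+ (k ℕ.+ k) ℕ.+ length L ∎)
    where
    lem : ∀ k → k ℕ.+ k ℕ.+ (k ℕ.+ k) ℕ.+ 6 ≡ 2 ℕ.* (2 ℕ.* suc k) ℕ.+ 2
    lem = ℕSolver.solve-∀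
  many : k ℕ.+ k ℕ.≤ suc (length Ps)
  many = ℕₚ.*-cancelˡ-≤ 2 (ℕₚ.+-cancelˡ-≤ 6 _ _ (begin
    6 ℕ.+ 2 ℕ.* (k ℕ.+ k) ≡⟨ lem k ⟩
    2 ℕ.* (2 ℕ.* suc k) ℕ.+ 2 ≤⟨ count ⟩
    length Ps ℕ.+ length Ps ℕ.+ length L ≤⟨ ℕₚ.+-monoʳ-≤ (length Ps ℕ.+ length Ps) eight ⟩
    length Ps ℕ.+ length Ps ℕ.+ 8 ≡⟨ lem′ (length Ps) ⟩
    6 ℕ.+ 2 ℕ.* suc (length Ps) ∎))
    where
    lem : ∀ k → 6 ℕ.+ 2 ℕ.* (k ℕ.+ k) ≡ 2 ℕ.* (2 ℕ.* suc k) ℕ.+ 2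
    lem = ℕSolver.solve-∀
    lem′ : ∀ m → m ℕ.+ m ℕ.+ 8 ≡ 6 ℕ.+ 2 ℕ.* suc m
    lem′ = ℕSolver.solve-∀

2∣⇒even : ∀ i → + 2 ∣ i → parity i ≡ false
2∣⇒even i (divides q e) = trans (cong parity (trans e (lem q)))
    (trans (parity-+ q q) (Boolₚ.xor-same (parity q)))
  where
  lem : ∀ q → q * + 2 ≡ q + q
  lem = solve-∀

odd⇒2∤ : ∀ i → parity i ≡ true → ¬ (+ 2 ∣ i)
odd⇒2∤ i e d with () ← trans (sym e) (2∣⇒even i d)

module _ {p k : ℕ} (pr : Prime p) (p≤ : p ℕ.≤ suc k) {S : List H} where

  arrange : ∀ {b b′ ws} → Reflection b → Reflection b′ → All (Rotation ∘ π) ws →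
    total (b ∷ b′ ∷ concat ws) ≡ 0ᶜ → Units p k (ex b - ex b′ ∷ map (ex ∘ π) ws) →
    length (concat ws) ℕ.+ 2 ≡ 2 ℕ.* p → b ∷ b′ ∷ concat ws ≼ S →
    Σ[ B ∈ Block (2 ℕ.* p) ] elements B ≼ S
  arrange {b} {b′} {ws} rb rb′ rots tot us len sub = package (trivial-arrangement rb rb′ pr rots tot us p≤)
    where
    package : ∃[ T ] (T ↭ b ∷ b′ ∷ concat ws × Trivial (2 ℕ.* p) (π T)) →
        Σ[ B ∈ Block (2 ℕ.* p) ] elements B ≼ S
    package (T , perm , triv) =
      block T (trans (↭-length perm) (trans (ℕₚ.+-comm 2 (length (concat ws))) len)) triv
          , ≼-trans (↭⇒≼ perm) sub

rotation-· : ∀ g h → isReflection g ≡ isReflection h → Rotation (π (g ∷ h ∷ []))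
rotation-· (_ , e , _) (_ , f , _) refl = trans (cong (e xor_) (Boolₚ.xor-identityʳ e)) (Boolₚ.xor-same e)

ex-singleton : ∀ g → ex (π (g ∷ [])) ≡ ex g
ex-singleton (i , false , _) = ℤₚ.+-identityʳ i
ex-singleton (i , true , _) = ℤₚ.+-identityʳ i

rotation-singleton : Rotation g → Rotation (π (g ∷ []))
rotation-singleton refl = refl

total≡⨁ : ∀ gs → total gs ≡ ⨁ (map class gs)
total≡⨁ [] = refl
total≡⨁ (g ∷ gs) = cong (class g ⊕_) (total≡⨁ gs)

-- For p = 2 one sign change with an odd entry suffices, so four leftover elements already form the
-- block.
hasBlock-4 : HasBlock 4
hasBlock-4 S l with pairs-or-classes prime[2] S l
... | inj₁ found = found
... | inj₂ (Ps , L , sub , u , six , _) =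
    use (find-block alternating-unavoidable (Allₚ.all-filter alternating? parallelograms)
    (λ {cs} → unique {cs}) u six)
  where
  unique : ∀ {cs} → Alternating cs → Unique cs
  unique {_ ∷ _ ∷ _ ∷ _ ∷ []} (u , _) = u
  use : ∃[ gs ] (Alternating (map class gs) × gs ≼ L) → Σ[ B ∈ Block 4 ] elements B ≼ S
  use (g ∷ h ∷ b ∷ b′ ∷ [] , (_ , tot , same , rb , rb′ , sign) , gs≼) = go sign
    where
    tot′ : total (b ∷ b′ ∷ g ∷ h ∷ []) ≡ 0ᶜ
    tot′ = trans (total-↭ (++-comm (b ∷ b′ ∷ []) (g ∷ h ∷ []))) (trans (total≡⨁ (g ∷ h ∷ b ∷ b′ ∷ [])) tot)
    inS : b ∷ b′ ∷ g ∷ h ∷ [] ≼ S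
    inS = ≼-trans (↭⇒≼ (++-comm (b ∷ b′ ∷ []) (g ∷ h ∷ [])))
        (≼-trans gs≼ (≼-trans (++-≼ʳ {xs = allMembers Ps}) sub))
    go : parity (ex b) xor parity (ex b′) ≡ true ⊎ (isReflection g ≡ false × parity (ex g) ≡ true) →
        Σ[ B ∈ Block 4 ] elements B ≼ S
    -- The sign change is the exchange of b and b′; g and h form one word because both may be
    -- reflections.
    go (inj₁ odd) = arrange {k = 1} prime[2] ℕₚ.≤-refl {b = b} {b′} {(g ∷ h ∷ []) ∷ []} rb rb′
        (rotation-· g h same ∷ []) tot′
      (unit
          (odd⇒2∤ (ex b - ex b′)
          (trans (parity-+ (ex b) (- ex b′))
          (trans (cong (parity (ex b) xor_) (parity-neg (ex b′))) odd))) (any []))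
      refl inS
    -- Now g and h are rotations, and the odd g is a word of its own that can be moved between the
    -- reflections.
    go (inj₂ (rot , odd)) = arrange {k = 1} prime[2] ℕₚ.≤-refl {b = b} {b′} {(g ∷ []) ∷ (h ∷ []) ∷ []} rb
        rb′
      (rotation-singleton {g} rot ∷ rotation-singleton {h} (trans (sym same) rot) ∷ []) tot′
      (any (unit (odd⇒2∤ _ (trans (cong parity (ex-singleton g)) odd)) (any []))) refl inS

-- Twice an odd prime

Units-++ : Units p k fs → Units p k′ gs → Units p (k ℕ.+ k′) (fs ++ gs)
Units-++ [] us = us
Units-++ (any vs) us = any (Units-++ vs us)
Units-++ (unit p∤ vs) us = unit p∤ (Units-++ vs us)

rotationClasses : List Class
rotationClasses = concatMap (λ a → map (λ c → a , false , c) bools) bools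

∈-rotationClasses : ∀ c → reflectionᶜ c ≡ false → c ∈ rotationClasses
∈-rotationClasses (false , false , false) refl = here refl
∈-rotationClasses (false , false , true) refl = there (here refl)
∈-rotationClasses (true , false , false) refl = there (there (here refl))
∈-rotationClasses (true , false , true) refl = there (there (there (here refl)))

Rotation-class : ∀ g h → class g ≡ class h → Rotation g → Rotation h
Rotation-class g h e rot = trans (sym (cong reflectionᶜ e)) rot

module OddPrime (i : ℕ) (pr : Prime (3 ℕ.+ i)) where

  private
    q = 3 ℕ.+ i

  -- The product of a pair is trivial modulo 2, so for a null pair it is trivial modulo 2q. A
  -- non-null pair is a word whose sign change is a unit.
  Null NonNull : Pair → Set
  Null P = + q ∣ ex (π (members P))
  NonNull P = ¬ Null P

  null? : Decidable Null
  null? P = + q ∣? ex (π (members P))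

  nonNull? : Decidable NonNull
  nonNull? P = ¬? (null? P)

  double-∣ : + 2 ∣ a → + q ∣ a → + (2 ℕ.* q) ∣ a
  double-∣ {a} (divides m e) d = finish (prime-∣* pr (subst (+ q ∣_) e d))
    where
    l1 : ∀ x p → (x * p) * + 2 ≡ x * (+ 2 * p)
    l1 = solve-∀
    finish : (+ q ∣ m) ⊎ (+ q ∣ + 2) → + (2 ℕ.* q) ∣ a
    finish (inj₁ (divides x e′)) =
      divides x (trans e (trans (cong (_* + 2) e′) (trans (l1 x (+ q)) (cong (x *_) (sym (ℤₚ.pos-* 2 q))))))
    finish (inj₂ q∣2) with s≤s (s≤s ()) ← ℕ∣.∣⇒≤ (∣⇒∣ᵤ q∣2)

  trivial-double : Trivial 2 g → + q ∣ ex g → Trivial (2 ℕ.* q) g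
  trivial-double (trivial d rot cen) e = trivial (double-∣ d e) rot cen

  nulls-trivial : ∀ {Qs} → All Null Qs → Trivial (2 ℕ.* q) (π (allMembers Qs))
  nulls-trivial [] = Trivial-ε
  nulls-trivial {Q ∷ Qs} (n ∷ ns) = subst (Trivial _) (sym (π-++ (members Q) (allMembers Qs)))
    (Trivial-· {g = π (members Q)} (trivial-double (members-trivial Q) n) (nulls-trivial ns))

  units-pairs : ∀ {Qs} → All NonNull Qs → Units q (length Qs) (map (ex ∘ π) (map members Qs))
  units-pairs [] = []
  units-pairs (n ∷ ns) = unit n (units-pairs ns)

  rotations-pairs : ∀ Qs → All (Rotation ∘ π) (map members Qs)
  rotations-pairs [] = []
  rotations-pairs (Q ∷ Qs) = rotation (members-trivial Q) ∷ rotations-pairs Qs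

  -- The two exponents add up to a unit, so one of them is a unit; either member represents the
  -- class.
  unit-member : ∀ Q → NonNull Q → Rotation (left Q) →
    ∃[ u ] (u ∷ [] ≼ members Q × ¬ (+ q ∣ ex u) × class u ≡ class (left Q))
  unit-member (pair g h e) nonNull rot with + q ∣? ex g
  ... | no q∤g = g , ++-≼ˡ , q∤g , refl
  ... | yes q∣g = h , ++-≼ʳ {xs = g ∷ []} , (λ q∣h → nonNull (subst (+ q ∣_) (sym exπ) (∣m∣n⇒∣m+n q∣g q∣h)))
      , sym e
    where
    exπ : ex (π (g ∷ h ∷ [])) ≡ ex g + ex h
    exπ = trans (ex-rotation {g} rot (π (h ∷ []))) (cong (_+_ (ex g)) (ex-singleton h))

  singleton-∤ : ¬ (+ q ∣ ex g) → ¬ (+ q ∣ ex (π (g ∷ [])))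
  singleton-∤ {g} q∤ d = q∤ (subst (+ q ∣_) (ex-singleton g) d)

  Goal : List H → Set
  Goal S = Σ[ B ∈ Block (2 ℕ.* q) ] elements B ≼ S

  -- Non-null pairs have total class zero and bring one unit each, so they can fill up any selection
  -- of total class zero. The count must reach q - 1 units and 2q elements.
  arrange-pairs : ∀ {S b b′ ws u} Qs → Reflection b → Reflection b′ → All (Rotation ∘ π) ws →
    total (b ∷ b′ ∷ concat ws) ≡ 0ᶜ → Units q u (ex b - ex b′ ∷ map (ex ∘ π) ws) →
    All NonNull Qs → u ℕ.+ length Qs ≡ 2 ℕ.+ i →
    length (concat ws) ℕ.+ (length Qs ℕ.+ length Qs) ℕ.+ 2 ≡ 2 ℕ.* q →
    b ∷ b′ ∷ concat ws ++ allMembers Qs ≼ S → Goal S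
  arrange-pairs {S} {b} {b′} {ws} {u} Qs rb rb′ rots tot us nonNull count len sub =
    arrange {k = 2 ℕ.+ i} pr ℕₚ.≤-refl {S} {b} {b′} {ws ++ map members Qs} rb rb′
      (Allₚ.++⁺ rots (rotations-pairs Qs))
      (trans (cong (λ xs → total (b ∷ b′ ∷ xs)) (sym joined))
        (trans (total-++ (b ∷ b′ ∷ concat ws) (allMembers Qs)) (cong₂ _⊕_ tot (total-allMembers Qs))))
      (subst₂ (Units q) count (cong (ex b - ex b′ ∷_) (sym (Listₚ.map-++ (ex ∘ π) ws (map members Qs))))
        (Units-++ us (units-pairs nonNull)))
      (trans
          (cong (ℕ._+ 2) (trans (cong length (sym joined))
          (trans (length-++ (concat ws)) (cong (length (concat ws) ℕ.+_) (length-allMembers Qs))))) len)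
      (subst (λ xs → b ∷ b′ ∷ xs ≼ S) joined sub)
    where
    joined : concat ws ++ allMembers Qs ≡ concat (ws ++ map members Qs)
    joined = Listₚ.concat-++ ws (map members Qs)

  nonNulls : ∀ Ps → All NonNull (filter nonNull? Ps)
  nonNulls Ps = Allₚ.all-filter nonNull? Ps

  module _ {S Ps L g h b b′} (sub : allMembers Ps ++ L ≼ S) (X≼L : g ∷ h ∷ b ∷ b′ ∷ [] ≼ L)
    (rg : Rotation g) (rh : Rotation h) (rb : Reflection b) (rb′ : Reflection b′)
    (tot : total (g ∷ h ∷ b ∷ b′ ∷ []) ≡ 0ᶜ) (g≢h : class g ≢ class h)
    (many : 2 ℕ.+ i ℕ.+ (2 ℕ.+ i) ℕ.≤ suc (length Ps)) where

    join : ∀ {xs Qs} → xs ≼ L → Qs ≼ Ps → xs ++ allMembers Qs ≼ S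
    join {xs} {Qs} x≼ Qs≼ = ≼-trans (↭⇒≼ (++-comm xs (allMembers Qs)))
        (≼-trans (≼-++ (concatMap-≼ members Qs≼) x≼) sub)

    reordered : b ∷ b′ ∷ g ∷ h ∷ [] ≼ L
    reordered = ≼-trans (↭⇒≼ (++-comm (b ∷ b′ ∷ []) (g ∷ h ∷ []))) X≼L

    tot′ : total (b ∷ b′ ∷ g ∷ h ∷ []) ≡ 0ᶜ
    tot′ = trans (total-↭ (++-comm (b ∷ b′ ∷ []) (g ∷ h ∷ []))) tot

    with-nulls : ∀ {Qs} → Qs ≼ Ps → All Null Qs → length Qs ≡ 3 ℕ.+ i → Goal S
    with-nulls {Qs} Qs≼ nulls len =
      block (allMembers Qs) (trans (length-allMembers Qs) (trans (cong (λ m → m ℕ.+ m) len) (lem i)))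
          (nulls-trivial nulls)
      , join {[]} (L , refl) Qs≼
      where
      lem : ∀ i → 3 ℕ.+ i ℕ.+ (3 ℕ.+ i) ≡ 2 ℕ.* (3 ℕ.+ i)
      lem = ℕSolver.solve-∀

    -- In the order g h b b′ the exponent is g + h + (b - b′), divisible by q, and it is even
    -- because the total class is zero.
    with-nulls-and-four : ∀ {Qs} → Qs ≼ Ps → All Null Qs → length Qs ≡ 1 ℕ.+ i →
      + q ∣ ex g → + q ∣ ex h → + q ∣ ex b - ex b′ → Goal S
    with-nulls-and-four {Qs} Qs≼ nulls len dg dh db =
      block ((g ∷ h ∷ b ∷ b′ ∷ []) ++ allMembers Qs)
        (trans (cong (4 ℕ.+_) (trans (length-allMembers Qs) (cong (λ m → m ℕ.+ m) len))) (lem i))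
        (subst (Trivial _) (sym (π-++ (g ∷ h ∷ b ∷ b′ ∷ []) (allMembers Qs)))
          (Trivial-· {g = π (g ∷ h ∷ b ∷ b′ ∷ [])}
            (trivial-double (class0⇒trivial _ (trans (class-π (g ∷ h ∷ b ∷ b′ ∷ [])) tot))
                (divisible g h b b′ rg rh rb dg dh db))
            (nulls-trivial nulls)))
      , join X≼L Qs≼
      where
      lem : ∀ i → 4 ℕ.+ (1 ℕ.+ i ℕ.+ (1 ℕ.+ i)) ≡ 2 ℕ.* (3 ℕ.+ i)
      lem = ℕSolver.solve-∀
      divisible : ∀ g h b b′ → Rotation g → Rotation h → Reflection b →
        + q ∣ ex g → + q ∣ ex h → + q ∣ ex b - ex b′ → + q ∣ ex (π (g ∷ h ∷ b ∷ b′ ∷ []))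
      divisible (i , _ , _) (j , _ , _) (k , _ , _) b′ refl refl refl dg dh db =
        ∣m∣n⇒∣m+n dg (∣m∣n⇒∣m+n dh (subst (λ m → + q ∣ k - m) (sym (ex-singleton b′)) db))

    -- The four elements bring one unit, and q - 2 non-null pairs bring the others.
    with-four : ∀ {c d} → Rotation c → Rotation d → total (b ∷ b′ ∷ c ∷ d ∷ []) ≡ 0ᶜ →
      Units q 1 (ex b - ex b′ ∷ ex (π (c ∷ [])) ∷ ex (π (d ∷ [])) ∷ []) →
      ∀ {Qs} → All NonNull Qs → length Qs ≡ 1 ℕ.+ i → b ∷ b′ ∷ c ∷ d ∷ allMembers Qs ≼ S → Goal S
    with-four {c} {d} rc rd t us {Qs} nonNull len sub =
        arrange-pairs {b = b} {b′} {(c ∷ []) ∷ (d ∷ []) ∷ []} Qs rb rb′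
      (rotation-singleton {c} rc ∷ rotation-singleton {d} rd ∷ []) t us nonNull (cong suc len)
      (trans (cong (λ m → 2 ℕ.+ (m ℕ.+ m) ℕ.+ 2) len) (lem i)) sub
      where
      lem : ∀ i → 2 ℕ.+ (1 ℕ.+ i ℕ.+ (1 ℕ.+ i)) ℕ.+ 2 ≡ 2 ℕ.* (3 ℕ.+ i)
      lem = ℕSolver.solve-∀

    -- The members of Q themselves act as the two reflections, and q - 1 non-null pairs supply all
    -- units.
    with-reflections : ∀ {Q Qs} → Q ∷ Qs ≼ Ps → Reflection (left Q) → All NonNull Qs → length Qs ≡ 2 ℕ.+ i →
        Goal S
    with-reflections {Q} {Qs} Qs≼ rl nonNull len = arrange-pairs {b = left Q} {right Q} {[]} Qs
      rl (trans (sym (cong reflectionᶜ (same-class Q))) rl) [] (total-members Q) (any []) nonNull len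
      (trans (cong (λ m → m ℕ.+ m ℕ.+ 2) len) (lem i)) (join {[]} (L , refl) Qs≼)
      where
      lem : ∀ i → 2 ℕ.+ i ℕ.+ (2 ℕ.+ i) ℕ.+ 2 ≡ 2 ℕ.* (3 ℕ.+ i)
      lem = ℕSolver.solve-∀

    -- A member of Q with unit exponent replaces c. It has the class of c, so the total is
    -- unchanged, and it brings the unit that `with-four` asks for.
    exchange : ∀ {c d Q Qs} → Rotation c → Rotation d → total (b ∷ b′ ∷ c ∷ d ∷ []) ≡ 0ᶜ →
        b ∷ b′ ∷ d ∷ [] ≼ L →
      Q ∷ Qs ≼ Ps → class (left Q) ≡ class c → All NonNull (Q ∷ Qs) → length Qs ≡ 1 ℕ.+ i → Goal S
    exchange {c} {d} {Q} {Qs} rc rd t bbd≼ Qs≼ same (nonNull ∷ nonNulls) len =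
      let u , u≼ , q∤u , cu = unit-member Q nonNull (Rotation-class c (left Q) (sym same) rc)
          cu′ = trans cu same in
      with-four {u} {d} (Rotation-class c u (sym cu′) rc) rd
        (trans (cong (λ z → class b ⊕ class b′ ⊕ z ⊕ class d ⊕ 0ᶜ) cu′) t)
        (any (unit (singleton-∤ {u} q∤u) (any []))) nonNulls len
        (≼-trans (≼-trans (↭⇒≼ (prep b (prep b′ (swap u d refl))))
            (≼-++ {xs = b ∷ b′ ∷ d ∷ []} bbd≼ (≼-++ u≼ (≼-refl {xs = allMembers Qs}))))
          (≼-trans (↭⇒≼ (++-comm L (allMembers (Q ∷ Qs))))
              (≼-trans (≼-++ (concatMap-≼ members Qs≼) ≼-refl) sub)))

    -- A member with unit exponent is taken from each of the two pairs. The two have equal class, so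
    -- adding them to g, h, b, b′ keeps the total zero and brings two units; q - 3 further pairs
    -- bring the others.
    merge : ∀ {Q Q′ Qs} → Q ∷ Q′ ∷ Qs ≼ Ps → class (left Q) ≡ class (left Q′) → Rotation (left Q) →
      All NonNull (Q ∷ Q′ ∷ Qs) → length Qs ≡ i → Goal S
    merge {Q} {Q′} {Qs} Qs≼ same rot (n ∷ n′ ∷ ns) len =
      let u , u≼ , q∤u , cu = unit-member Q n rot
          u′ , u′≼ , q∤u′ , cu′ = unit-member Q′ n′ (Rotation-class (left Q) (left Q′) same rot)
          eq = trans cu (trans same (sym cu′)) in
      arrange-pairs {b = b} {b′} {(g ∷ []) ∷ (h ∷ []) ∷ (u ∷ []) ∷ (u′ ∷ []) ∷ []} Qs rb rb′
        (rotation-singleton {g} rg ∷ rotation-singleton {h} rh ∷ rotation-singleton {u}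
            (Rotation-class (left Q) u (sym cu) rot)
          ∷ rotation-singleton {u′} (Rotation-class (left Q) u′ (trans (sym cu) eq) rot) ∷ [])
        (trans (total-++ (b ∷ b′ ∷ g ∷ h ∷ []) (u ∷ u′ ∷ []))
            (cong₂ _⊕_ tot′ (total-members (pair u u′ eq))))
        (any (any (any (unit (singleton-∤ {u} q∤u) (unit (singleton-∤ {u′} q∤u′) [])))))
        ns (cong (2 ℕ.+_) len) (trans (cong (λ m → 4 ℕ.+ (m ℕ.+ m) ℕ.+ 2) len) (lem i))
        (≼-trans (≼-++ reordered (≼-++ u≼ (≼-++ u′≼ (≼-refl {xs = allMembers Qs}))))
          (≼-trans (↭⇒≼ (++-comm L (allMembers (Q ∷ Q′ ∷ Qs))))
              (≼-trans (≼-++ (concatMap-≼ members Qs≼) ≼-refl) sub)))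
      where
      lem : ∀ i → 4 ℕ.+ (i ℕ.+ i) ℕ.+ 2 ≡ 2 ℕ.* (3 ℕ.+ i)
      lem = ℕSolver.solve-∀

    -- There are only four classes of rotations, two of which are those of g and h.
    many-rotations : ∀ Qs → Qs ≼ Ps → 3 ℕ.+ i ℕ.≤ length Qs → All NonNull Qs → All (Rotation ∘ left) Qs →
      All (λ Q → class (left Q) ≢ class g) Qs → All (λ Q → class (left Q) ≢ class h) Qs → Goal S
    many-rotations [] _ () _ _ _ _
    many-rotations (_ ∷ []) _ (s≤s ()) _ _ _ _
    many-rotations (_ ∷ _ ∷ []) _ (s≤s (s≤s ())) _ _ _ _
    many-rotations (Q₁ ∷ Q₂ ∷ Q₃ ∷ Qs) sub′ (s≤s (s≤s (s≤s l))) (n₁ ∷ n₂ ∷ n₃ ∷ ns) (r₁ ∷ r₂ ∷ r₃ ∷ _)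
      (g₁ ∷ g₂ ∷ g₃ ∷ _) (h₁ ∷ h₂ ∷ h₃ ∷ _) = cases (c₁ ≟ᶜ c₂) (c₁ ≟ᶜ c₃) (c₂ ≟ᶜ c₃)
      where
      c₁ = class (left Q₁)
      c₂ = class (left Q₂)
      c₃ = class (left Q₃)
      rest : ∃[ Rs ] (Rs ≼ Qs × length Rs ≡ i)
      rest = take-≼ i l
      Rs = proj₁ rest
      Rs≼ = proj₁ (proj₂ rest)
      lenR = proj₂ (proj₂ rest)
      nsR : All NonNull Rs
      nsR = All-≼ Rs≼ ns
      shorter : Q₁ ∷ Q₂ ∷ Q₃ ∷ Rs ≼ Ps
      shorter = ≼-trans (≼-∷ Q₁ (≼-∷ Q₂ (≼-∷ Q₃ Rs≼))) sub′
      drop-one : ∀ {P P′ P″} → P″ ∷ P ∷ P′ ∷ Rs ≼ Ps → P ∷ P′ ∷ Rs ≼ Ps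
      drop-one {P″ = P″} = ≼-trans (++-≼ʳ {xs = P″ ∷ []})
      cases : Dec (c₁ ≡ c₂) → Dec (c₁ ≡ c₃) → Dec (c₂ ≡ c₃) → Goal S
      cases (yes e) _ _ = merge
          (drop-one {P″ = Q₃}
          (≼-trans (↭⇒≼ (↭-trans (swap Q₃ Q₁ refl) (prep Q₁ (swap Q₃ Q₂ refl)))) shorter)) e r₁
          (n₁ ∷ n₂ ∷ nsR) lenR
      cases (no _) (yes e) _ = merge (drop-one {P″ = Q₂} (≼-trans (↭⇒≼ (swap Q₂ Q₁ refl)) shorter)) e r₁
          (n₁ ∷ n₃ ∷ nsR) lenR
      cases (no _) (no _) (yes e) = merge (drop-one {P″ = Q₁} shorter) e r₂ (n₂ ∷ n₃ ∷ nsR) lenR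
      cases (no ¬12) (no ¬13) (no ¬23) = contradiction
        (≼-length (unique-≼ {xs = class g ∷ class h ∷ c₁ ∷ c₂ ∷ c₃ ∷ []} {ys = rotationClasses} id
          ((g≢h ∷ ≢-sym g₁ ∷ ≢-sym g₂ ∷ ≢-sym g₃ ∷ []) ∷ (≢-sym h₁ ∷ ≢-sym h₂ ∷ ≢-sym h₃ ∷ []) ∷
              (¬12 ∷ ¬13 ∷ []) ∷ (¬23 ∷ []) ∷ [] ∷ [])
          (∈-rotationClasses _ rg ∷ ∈-rotationClasses _ rh ∷ ∈-rotationClasses _ r₁ ∷ ∈-rotationClasses _
              r₂ ∷ ∈-rotationClasses _ r₃ ∷ [])))
        (ℕₚ.<⇒≱ ℕₚ.≤-refl)

    take-others : ∀ {Q} m → Q ∈ filter nonNull? Ps → suc m ℕ.≤ length (filter nonNull? Ps) →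
      ∃[ Qs ] (Q ∷ Qs ≼ filter nonNull? Ps × length Qs ≡ m)
    take-others {Q} m Q∈ l with ∈⇒↭∷ Q∈
    ... | Rs , perm with take-≼ {xs = Rs} m (ℕ.s≤s⁻¹ (subst (suc m ℕ.≤_) (↭-length perm) l))
    ...   | Qs , Qs≼ , len = Qs , ≼-trans (≼-∷ Q Qs≼) (↭⇒≼ (↭-sym perm)) , len

    -- A pair of reflections can take the place of b and b′, and a pair in the class of g or h can
    -- lend a unit to it. Otherwise all pairs consist of rotations outside those two classes.
    many-nonNull : 3 ℕ.+ i ℕ.≤ length (filter nonNull? Ps) → Goal S
    many-nonNull l with any? (λ Q → isReflection (left Q) Boolₚ.≟ true) (filter nonNull? Ps)
    ... | yes some = let Q , Q∈ , rl = find some ; Qs , Qs≼ , len = take-others (2 ℕ.+ i) Q∈ l in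
      with-reflections (≼-trans Qs≼ (filter-≼ nonNull? Ps)) rl (All.tail (All-≼ Qs≼ (nonNulls Ps))) len
    ... | no none with any? (λ Q → class (left Q) ≟ᶜ class g) (filter nonNull? Ps)
    ...   | yes some = let Q , Q∈ , e = find some ; Qs , Qs≼ , len = take-others (1 ℕ.+ i) Q∈ (ℕₚ.<⇒≤ l) in
      exchange {g} {h} rg rh tot′ (≼-trans (≼-∷ b (≼-∷ b′ (++-≼ʳ {xs = g ∷ []}))) reordered)
        (≼-trans Qs≼ (filter-≼ nonNull? Ps)) e (All-≼ Qs≼ (nonNulls Ps)) len
    ...   | no none-g with any? (λ Q → class (left Q) ≟ᶜ class h) (filter nonNull? Ps)
    ...     | yes some = let Q , Q∈ , e = find some ; Qs , Qs≼ , len = take-others (1 ℕ.+ i) Q∈ (ℕₚ.<⇒≤ l) in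
      exchange {h} {g} rh rg (trans (total-↭ (prep b (prep b′ (swap h g (refl {xs = []}))))) tot′)
        (≼-trans (≼-∷ b (≼-∷ b′ (≼-∷ g (h ∷ [] , refl)))) reordered)
        (≼-trans Qs≼ (filter-≼ nonNull? Ps)) e (All-≼ Qs≼ (nonNulls Ps)) len
    ...     | no none-h = many-rotations (filter nonNull? Ps) (filter-≼ nonNull? Ps) l (nonNulls Ps)
      (All.map (λ {Q} → Boolₚ.¬-not) (Allₚ.¬Any⇒All¬ _ none)) (Allₚ.¬Any⇒All¬ _ none-g)
          (Allₚ.¬Any⇒All¬ _ none-h)

    -- q null pairs form a block. Otherwise there are q - 2 non-null pairs, enough if g, h or b - b′
    -- gives a unit. If none does, q - 2 null pairs complete g, h, b, b′; with fewer null pairs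
    -- there are at least q non-null ones.
    solve-mixed : Goal S
    solve-mixed with 3 ℕ.+ i ℕ.≤? length (filter null? Ps)
    ... | yes l = let Qs , Qs≼ , len = take-≼ (3 ℕ.+ i) l in
      with-nulls (≼-trans Qs≼ (filter-≼ null? Ps)) (All-≼ Qs≼ (Allₚ.all-filter null? Ps)) len
    ... | no few = by-divisibility (+ q ∣? ex g) (+ q ∣? ex h) (+ q ∣? ex b - ex b′)
      where
      counts : length (filter null? Ps) ℕ.+ length (filter nonNull? Ps) ≡ length Ps
      counts = length-filter-∁ null? Ps
      -- There are at least 2q - 3 pairs, so at most m + q - 3 null ones leave at least q - m that
      -- are non-null.
      complement : ∀ m → length (filter null? Ps) ℕ.≤ m ℕ.+ i →
          3 ℕ.+ i ℕ.≤ m ℕ.+ length (filter nonNull? Ps)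
      complement m l = ℕ.s≤s⁻¹ (ℕₚ.+-cancelˡ-≤ i _ _ (begin
        i ℕ.+ suc (3 ℕ.+ i) ≡⟨ lem i ⟩
        2 ℕ.+ i ℕ.+ (2 ℕ.+ i) ≤⟨ many ⟩
        suc (length Ps) ≡⟨ cong suc counts ⟨
        suc (length (filter null? Ps) ℕ.+ length (filter nonNull? Ps)) ≤⟨ s≤s (ℕₚ.+-monoˡ-≤ _ l) ⟩
        suc (m ℕ.+ i ℕ.+ length (filter nonNull? Ps)) ≡⟨ lem′ m i (length (filter nonNull? Ps)) ⟩
        i ℕ.+ suc (m ℕ.+ length (filter nonNull? Ps)) ∎))
        where
        open ℕₚ.≤-Reasoning
        lem : ∀ i → i ℕ.+ suc (3 ℕ.+ i) ≡ 2 ℕ.+ i ℕ.+ (2 ℕ.+ i)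
        lem = ℕSolver.solve-∀
        lem′ : ∀ m i n → suc (m ℕ.+ i ℕ.+ n) ≡ i ℕ.+ suc (m ℕ.+ n)
        lem′ = ℕSolver.solve-∀
      enough : 1 ℕ.+ i ℕ.≤ length (filter nonNull? Ps)
      enough = ℕₚ.+-cancelˡ-≤ 2 _ _ (complement 2 (ℕ.s≤s⁻¹ (ℕₚ.≰⇒> few)))
      by-nonNull : Units q 1 (ex b - ex b′ ∷ ex (π (g ∷ [])) ∷ ex (π (h ∷ [])) ∷ []) → Goal S
      by-nonNull us = let Qs , Qs≼ , len = take-≼ (1 ℕ.+ i) enough ; Qs≼Ps = ≼-trans Qs≼ (filter-≼ nonNull? Ps) in
        with-four rg rh tot′ us (All-≼ Qs≼ (nonNulls Ps)) len (join reordered Qs≼Ps)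
      by-divisibility : Dec (+ q ∣ ex g) → Dec (+ q ∣ ex h) → Dec (+ q ∣ ex b - ex b′) → Goal S
      by-divisibility (no ¬d) _ _ = by-nonNull (any (unit (singleton-∤ {g} ¬d) (any [])))
      by-divisibility _ (no ¬d) _ = by-nonNull (any (any (unit (singleton-∤ {h} ¬d) [])))
      by-divisibility _ _ (no ¬d) = by-nonNull (unit ¬d (any (any [])))
      by-divisibility (yes dg) (yes dh) (yes db) with 1 ℕ.+ i ℕ.≤? length (filter null? Ps)
      ... | yes l = let Qs , Qs≼ , len = take-≼ (1 ℕ.+ i) l in
        with-nulls-and-four (≼-trans Qs≼ (filter-≼ null? Ps))
            (All-≼ Qs≼ (Allₚ.all-filter null? Ps)) len dg dh db
      ... | no fewer = many-nonNull (complement 0 (ℕ.s≤s⁻¹ (ℕₚ.≰⇒> fewer)))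

  hasBlock-2p : HasBlock (2 ℕ.* q)
  hasBlock-2p S l = use (pairs-or-classes pr S l)
    where
    unique : ∀ {cs} → Mixed cs → Unique cs
    unique {_ ∷ _ ∷ _ ∷ _ ∷ []} (u , _) = u
    use-block : ∀ {Ps L} → allMembers Ps ++ L ≼ S → 2 ℕ.+ i ℕ.+ (2 ℕ.+ i) ℕ.≤ suc (length Ps) →
      ∃[ gs ] (Mixed (map class gs) × gs ≼ L) → Goal S
    use-block {Ps} sub many (g ∷ h ∷ b ∷ b′ ∷ [] , (((g≢h ∷ _) ∷ _) , tot , rg , rh , rb , rb′) , gs≼) =
      solve-mixed {Ps = Ps} sub gs≼ rg rh rb rb′ (trans (total≡⨁ (g ∷ h ∷ b ∷ b′ ∷ [])) tot) g≢h many
    use : _ → Goal S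
    use (inj₁ found) = found
    use (inj₂ (Ps , L , sub , u , six , many)) = use-block {Ps} sub many
      (find-block mixed-unavoidable (Allₚ.all-filter mixed? parallelograms) (λ {cs} → unique {cs}) u six)

-- All even n from twice a prime

hasBlock-2* : ∀ {p} → Prime p → HasBlock (2 ℕ.* p)
hasBlock-2* {0} pr = contradiction pr ¬prime[0]
hasBlock-2* {1} pr = contradiction pr ¬prime[1]
hasBlock-2* {2} pr = hasBlock-4
hasBlock-2* {suc (suc (suc i))} pr = OddPrime.hasBlock-2p i pr

hasBlock-product : ∀ {n} → HasBlock n → ∀ {ps} → All Prime ps → HasBlock (n ℕ.* product ps)
hasBlock-product {n} hb [] = subst HasBlock (sym (ℕₚ.*-identityʳ n)) hb
hasBlock-product {n} hb {zero ∷ _} (pr ∷ _) = contradiction pr ¬prime[0]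
hasBlock-product {n} hb {suc k ∷ ps} (pr ∷ prs) =
  subst HasBlock (ℕₚ.*-assoc n (suc k) (product ps)) (hasBlock-product (hasBlock-* pr hb) prs)

hasBlock-even : ∀ m → 2 ℕ.≤ m → HasBlock (2 ℕ.* m)
hasBlock-even (suc zero) (s≤s ())
hasBlock-even m@(suc (suc _)) _ = from (factorise m)
  where
  from : PrimeFactorisation m → HasBlock (2 ℕ.* m)
  from record { factors = [] ; isFactorisation = () }
  from record { factors = p ∷ ps ; isFactorisation = e ; factorsPrime = pr ∷ prs } =
    subst HasBlock (trans (ℕₚ.*-assoc 2 p (product ps)) (cong (2 ℕ.*_) (sym e)))
        (hasBlock-product (hasBlock-2* pr) prs)

-- Passage to D_{2n} × C₂

≼-map⁻ : (f : A → B) {xs : List A} {ys : List B} → ys ≼ map f xs → ∃[ zs ] (zs ≼ xs × map f zs ≡ ys)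
≼-map⁻ f {ys = ys} (us , p) with ↭-map-inv f p
... | ws , e , q with split-map ys ws (sym e)
  where
  split-map : ∀ ys {us} ws → map f ws ≡ ys ++ us → ∃[ as ] ∃[ bs ] (ws ≡ as ++ bs × map f as ≡ ys)
  split-map [] ws e = [] , ws , refl , refl
  split-map (y ∷ ys) (w ∷ ws) e with split-map ys ws (Listₚ.∷-injectiveʳ e)
  ... | as , bs , refl , e′ = w ∷ as , bs , refl , cong₂ _∷_ (Listₚ.∷-injectiveˡ e) e′
...   | as , bs , refl , e′ = as , (bs , q) , e′

⊆-++⁻ : ∀ {xs : List A} ys {zs} → xs ⊆ ys ++ zs → ∃[ as ] ∃[ bs ] (xs ≡ as ++ bs × as ⊆ ys × bs ⊆ zs)
⊆-++⁻ [] s = [] , _ , refl , [] , s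
⊆-++⁻ (y ∷ ys) (.y ∷ʳ s) with ⊆-++⁻ ys s
... | as , bs , e , p , q = as , bs , e , y ∷ʳ p , q
⊆-++⁻ (y ∷ ys) (refl ∷ s) with ⊆-++⁻ ys s
... | as , bs , e , p , q = y ∷ as , bs , cong (y ∷_) e , refl ∷ p , q

⊆-replicate : ∀ {x : A} {xs} k → xs ⊆ replicate k x → ∃[ j ] (xs ≡ replicate j x × j ℕ.≤ k)
⊆-replicate zero [] = 0 , refl , z≤n
⊆-replicate (suc k) (_ ∷ʳ s) = let j , e , l = ⊆-replicate k s in j , e , ℕₚ.m≤n⇒m≤1+n l
⊆-replicate {x = x} (suc k) (refl ∷ s) = let j , e , l = ⊆-replicate k s in suc j , cong (x ∷_) e , s≤s l

mod-neg : ∀ {n a b} → a ≡ b mod n → - a ≡ - b mod n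
mod-neg {n} {a} {b} (congruent d) = congruent (subst (+ n ∣_) (lem a b) (∣m⇒∣-m d))
  where
  lem : ∀ a b → - (a - b) ≡ - a - - b
  lem = solve-∀

mod-injective : ∀ {n i j} → i ℕ.< n → j ℕ.< n → + i ≡ + j mod n → i ≡ j
mod-injective {n} {i} {j} i<n j<n (congruent d) =
    ℤₚ.+-injective (ℤₚ.i-j≡0⇒i≡j (+ i) (+ j) (ℤₚ.∣i∣≡0⇒i≡0 (vanish _ small (∣⇒∣ᵤ d))))
  where
  small : ∣ + i - + j ∣ ℕ.< n
  small = ℕₚ.≤-<-trans (ℕₚ.≤-reflexive (cong ∣_∣ (ℤₚ.m-n≡m⊖n i j)))
    (ℕₚ.≤-<-trans (ℤₚ.∣m⊝n∣≤m⊔n i j) (ℕₚ.⊔-pres-<m i<n j<n))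
  vanish : ∀ m → m ℕ.< n → n ℕ∣.∣ m → m ≡ 0
  vanish zero _ _ = refl
  vanish (suc m) m<n n∣m = contradiction n∣m (ℕ∣.>⇒∤ m<n)

module _ {n : ℕ} .{{_ : ℕ.NonZero n}} where

  infix 4 _∼_

  -- h ∈ D_∞ × C₂ lifts g ∈ D_{2n} × C₂
  record _∼_ (g : G n) (h : H) : Set where
    constructor lift
    field
      exponent : + toℕ (proj₁ g) ≡ ex h mod n
      flags : proj₂ g ≡ proj₂ h
  open _∼_

  fin-mod : ∀ k → + toℕ (fin n k) ≡ + k mod n
  fin-mod k = subst (λ r → + r ≡ + k mod n) (sym (toℕ-fromℕ< (m%n<n k n)))
    (mod-sym (congruent (divides (+ (k ℕ./ n)) (trans (cong (λ z → + z - + (k ℕ.% n)) (m≡m%n+[m/n]*n k n))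
      (trans
          (cong (_- + (k ℕ.% n))
          (trans (ℤₚ.pos-+ (k ℕ.% n) _) (cong (_+_ (+ (k ℕ.% n))) (ℤₚ.pos-* (k ℕ./ n) n))))
          (lem (+ (k ℕ.% n)) (+ (k ℕ./ n) * + n)))))))
    where
    lem : ∀ r s → r + s - r ≡ s
    lem = solve-∀

  negMod-mod : ∀ j → + toℕ (negMod n j) ≡ - (+ toℕ j) mod n
  negMod-mod j = mod-trans (fin-mod (n ℕ.∸ toℕ j)) (congruent (divides 1ℤ
    (trans (cong (_- - (+ toℕ j)) (trans (sym (ℤₚ.⊖-≥ (ℕₚ.<⇒≤ (toℕ<n j)))) (sym (ℤₚ.m-n≡m⊖n n (toℕ j)))))
        (lem (+ n) (+ toℕ j)))))
    where
    lem : ∀ n j → (n - j) - (- j) ≡ 1ℤ * n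
    lem = solve-∀

  mul-∼ : ∀ {g g′ h h′} → g ∼ h → g′ ∼ h′ → mul n g g′ ∼ h · h′
  mul-∼ {i , e , c} {j , f , d} (lift p refl) (lift q refl) = lift
    (mod-trans (fin-mod (toℕ i ℕ.+ toℕ (if e then negMod n j else j))) (mod-+ p (signs e))) refl
    where
    signs : ∀ e → + toℕ (if e then negMod n j else j) ≡ signed e _ mod n
    signs false = q
    signs true = mod-trans (negMod-mod j) (mod-neg q)

  one-∼ : one n ∼ ε
  one-∼ = lift (fin-mod 0) refl

  prod-∼ : ∀ {gs hs} → Pointwise _∼_ gs hs → prod n gs ∼ π hs
  prod-∼ [] = one-∼
  prod-∼ (r ∷ rs) = mul-∼ r (prod-∼ rs)

  ∼-injective : ∀ {g g′ h} → g ∼ h → g′ ∼ h → g ≡ g′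
  ∼-injective {i , _} {j , _} (lift p refl) (lift q refl) =
    cong (_, _) (toℕ-injective (mod-injective (toℕ<n i) (toℕ<n j) (mod-trans p (mod-sym q))))

  trivial⇒one : ∀ {g h} → g ∼ h → Trivial n h → g ≡ one n
  trivial⇒one {h = i , _ , _} (lift p flags) (trivial d refl refl) =
    ∼-injective {h = ε} (lift (mod-trans p (∣⇒mod0 d)) flags) one-∼

  one⇒trivial : ∀ {g h} → g ∼ h → g ≡ one n → Trivial n h
  one⇒trivial {h = i , _ , _} (lift p refl) refl =
      trivial (mod0⇒∣ (mod-trans (mod-sym p) (fin-mod 0))) refl refl

  ι-lifts : ∀ g → g ∼ (+ toℕ (proj₁ g) , proj₂ g)
  ι-lifts g = lift mod-refl refl

  ι : G n → H
  ι g = + toℕ (proj₁ g) , proj₂ g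

  ι-∼ : ∀ gs → Pointwise _∼_ gs (map ι gs)
  ι-∼ [] = []
  ι-∼ (g ∷ gs) = ι-lifts g ∷ ι-∼ gs

  mul-oneˡ : ∀ g → mul n (one n) g ≡ g
  mul-oneˡ g = ∼-injective (mul-∼ one-∼ (ι-lifts g)) (subst (g ∼_) (sym (·-identityˡ (ι g))) (ι-lifts g))

  prod-drop-one : ∀ as bs → prod n (as ++ one n ∷ bs) ≡ prod n (as ++ bs)
  prod-drop-one [] bs = mul-oneˡ (prod n bs)
  prod-drop-one (a ∷ as) bs = cong (mul n a) (prod-drop-one as bs)

  OneInπ-drop-ones : ∀ j {T} → OneInπ n (replicate j (one n) ++ T) → OneInπ n T
  OneInπ-drop-ones zero o = o
  OneInπ-drop-ones (suc j) (T′ , perm , e) with ∈-∃++ (∈-resp-↭ (↭-sym perm) (here refl))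
  ... | as , bs , refl = OneInπ-drop-ones j
      (as ++ bs , drop-mid as [] perm , trans (sym (prod-drop-one as bs)) e)

  hasBlock⇒SProp : HasBlock n → SProp n n (2 ℕ.* n ℕ.+ 2)
  hasBlock⇒SProp hb S l = use (hb (map ι S) (subst (2 ℕ.* n ℕ.+ 2 ℕ.≤_) (sym (length-map ι S)) l))
    where
    use : Σ[ B ∈ Block n ] elements B ≼ map ι S → _
    use (block T size triv , T≼) with ≼-map⁻ ι T≼
    ... | T′ , T′≼S , refl with ≼⇒⊆ T′≼S
    ...   | Z , Z⊆S , perm = Z , Z⊆S , trans (sym (↭-length perm)) (trans (sym (length-map ι T′)) size)
            , T′ , perm , trivial⇒one (prod-∼ (ι-∼ T′)) triv

  -- A subsequence of length n cannot consist of the n - 1 appended identities alone. Deleting those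
  -- it contains leaves a nonempty part of `S` of length at most n that still has product one.
  SProp⇒EtaProp : ∀ {ℓ m} → ℓ ℕ.< m ℕ.+ n → SProp n n ℓ → EtaProp n n m
  SProp⇒EtaProp {ℓ} {m} ℓ< sprop S m≤ = use (sprop (replicate (ℕ.pred n) (one n) ++ S) long)
    where
    long : ℓ ℕ.≤ length (replicate (ℕ.pred n) (one n) ++ S)
    long = ℕ.s≤s⁻¹ (begin
      suc ℓ ≤⟨ ℓ< ⟩
      m ℕ.+ n ≤⟨ ℕₚ.+-monoˡ-≤ n m≤ ⟩
      length S ℕ.+ n ≡⟨ ℕₚ.+-comm (length S) n ⟩
      n ℕ.+ length S ≡⟨ cong (ℕ._+ length S) (ℕₚ.suc-pred n) ⟨
      suc (ℕ.pred n ℕ.+ length S) ≡⟨ cong (λ k → suc (k ℕ.+ length S)) (Listₚ.length-replicate (ℕ.pred n)) ⟨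
      suc (length (replicate (ℕ.pred n) (one n)) ℕ.+ length S) ≡⟨ cong suc
          (length-++ (replicate (ℕ.pred n) (one n))) ⟨
      suc (length (replicate (ℕ.pred n) (one n) ++ S)) ∎)
      where open ℕₚ.≤-Reasoning
    use : ∃[ T ] (T ⊆ replicate (ℕ.pred n) (one n) ++ S × length T ≡ n × OneInπ n T) → _
    use (T , T⊆ , len , o) with ⊆-++⁻ (replicate (ℕ.pred n) (one n)) T⊆
    ... | as , bs , refl , as⊆ , bs⊆ with ⊆-replicate (ℕ.pred n) as⊆
    ...   | j , refl , j≤ = bs , bs⊆ , nonempty , subst (length bs ℕ.≤_) sizes (ℕₚ.m≤n+m (length bs) j)
        , OneInπ-drop-ones j o
      where
      sizes : j ℕ.+ length bs ≡ n
      sizes = trans (cong (ℕ._+ length bs) (sym (Listₚ.length-replicate j)))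
          (trans (sym (length-++ (replicate j (one n)))) len)
      nonempty : 1 ℕ.≤ length bs
      nonempty = ℕₚ.+-cancelˡ-≤ j 1 (length bs) (ℕₚ.≤-trans (ℕₚ.≤-reflexive (ℕₚ.+-comm j 1))
        (ℕₚ.≤-trans (s≤s j≤) (ℕₚ.≤-reflexive (trans (ℕₚ.suc-pred n) (sym sizes)))))

-- The exponent and the lower bounds

π-rotations-↭ : ∀ {xs ys} → All Rotation xs → xs ↭ ys → π xs ≡ π ys
π-rotations-↭ _ refl = refl
π-rotations-↭ (_ ∷ rs) (prep x p) = cong (x ·_) (π-rotations-↭ rs p)
π-rotations-↭ (r ∷ r′ ∷ rs) (swap x y p) =
    trans (cong (λ g → x · (y · g)) (π-rotations-↭ rs p)) (lem x y r r′ _)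
  where
  l : ∀ i j k → i + (j + k) ≡ j + (i + k)
  l = solve-∀
  lem : ∀ x y → Rotation x → Rotation y → ∀ g → x · (y · g) ≡ y · (x · g)
  lem (i , _ , c) (j , _ , d) refl refl (k , e , c′) = ≡-H (l i j k) refl
    (trans (sym (Boolₚ.xor-assoc c d c′))
        (trans (cong (_xor c′) (Boolₚ.xor-comm c d)) (Boolₚ.xor-assoc d c c′)))
π-rotations-↭ rs (_↭_.trans p q) = trans (π-rotations-↭ rs p) (π-rotations-↭ (All-resp-↭ p rs) q)

π-replicate : ∀ k i ys → ex (π (replicate k (i , false , false) ++ ys)) ≡ + k * i + ex (π ys)
π-replicate zero i ys = sym (trans (cong (_+ ex (π ys)) (ℤₚ.*-zeroˡ i)) (ℤₚ.+-identityˡ _))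
π-replicate (suc k) i ys = trans (cong (_+_ i) (π-replicate k i ys)) (lem i (+ k) (ex (π ys)))
  where
  lem : ∀ i k y → i + (k * i + y) ≡ (1ℤ + k) * i + y
  lem = solve-∀

flags-replicate : ∀ k i ys → proj₂ (total (replicate k (i , false , false) ++ ys)) ≡ proj₂ (total ys)
flags-replicate zero i ys = refl
flags-replicate (suc k) i ys = flags-replicate k i ys

trivial-power : ∀ m h → Trivial (m ℕ.* 2) (π (replicate (m ℕ.* 2) h))
trivial-power m (i , true , c) = subst (Trivial _) (sym (go m)) Trivial-ε
  where
  l : ∀ i → i - (i - 0ℤ) ≡ 0ℤ
  l = solve-∀
  go : ∀ m → π (replicate (m ℕ.* 2) (i , true , c)) ≡ ε
  go zero = refl
  go (suc m) = trans (cong (λ g → (i , true , c) · ((i , true , c) · g)) (go m))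
    (≡-H (l i) refl (trans (cong (c xor_) (Boolₚ.xor-identityʳ c)) (Boolₚ.xor-same c)))
trivial-power m (i , false , c) = subst (Trivial _) (sym (go m)) (trivial (∣m⇒∣m*n i ∣-refl) refl refl)
  where
  l : ∀ i m → i + (i + m * i) ≡ (1ℤ + (1ℤ + m)) * i
  l = solve-∀
  go : ∀ m → π (replicate (m ℕ.* 2) (i , false , c)) ≡ (+ (m ℕ.* 2) * i , false , false)
  go zero = ≡-H (sym (ℤₚ.*-zeroˡ i)) refl refl
  go (suc m) = trans (cong (λ g → (i , false , c) · ((i , false , c) · g)) (go m))
    (≡-H (l i (+ (m ℕ.* 2))) refl (trans (cong (c xor_) (Boolₚ.xor-identityʳ c)) (Boolₚ.xor-same c)))

module _ {n : ℕ} .{{_ : ℕ.NonZero n}} where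

  pow-∼ : ∀ {g h} → g ∼ h → ∀ k → pow n g k ∼ π (replicate k h)
  pow-∼ r zero = one-∼
  pow-∼ r (suc k) = mul-∼ r (pow-∼ r k)

  isExp : 2 ℕ.≤ n → 2 ℕ∣.∣ n → IsExp n n
  isExp 2≤n (ℕ∣.divides m e) = ℕₚ.≤-trans (s≤s z≤n) 2≤n
    , (λ g → trivial⇒one (pow-∼ (ι-lifts g) n)
        (subst (λ k → Trivial k (π (replicate k (ι g)))) (sym e) (trivial-power m (ι g))))
    -- Minimality is witnessed by x, whose k-th power is trivial only if n divides k.
    , λ k 0<k k<n pow≡1 → ℕ∣.>⇒∤ {{ℕ.>-nonZero 0<k}} k<n
        (subst (n ℕ∣.∣_)
            (cong ∣_∣ (trans (cong (ex ∘ π) (sym (Listₚ.++-identityʳ (replicate k (1ℤ , false , false)))))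
            (trans (π-replicate k 1ℤ []) (lem (+ k)))))
          (∣⇒∣ᵤ
              (n∣ex
              (one⇒trivial
              (pow-∼ {fin n 1 , false , false} {1ℤ , false , false} (lift (fin-mod 1) refl) k)
              (pow≡1 _)))))
    where
    lem : ∀ k → k * 1ℤ + 0ℤ ≡ k
    lem = solve-∀

  private
    x xz z y : G n
    x = fin n 1 , false , false
    xz = fin n 1 , false , true
    z = fin n 0 , false , true
    y = fin n 0 , true , false

  extremal : List (G n)
  extremal = replicate (ℕ.pred n) x ++ xz ∷ z ∷ y ∷ []

  length-extremal : length extremal ≡ n ℕ.+ 2
  length-extremal = begin
    length extremal ≡⟨ length-++ (replicate (ℕ.pred n) x) ⟩
    length (replicate (ℕ.pred n) x) ℕ.+ 3 ≡⟨ cong (ℕ._+ 3) (Listₚ.length-replicate (ℕ.pred n)) ⟩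
    ℕ.pred n ℕ.+ 3 ≡⟨ ℕₚ.+-suc (ℕ.pred n) 2 ⟩
    suc (ℕ.pred n) ℕ.+ 2 ≡⟨ cong (ℕ._+ 2) (ℕₚ.suc-pred n) ⟩
    n ℕ.+ 2 ∎
    where open ≡-Reasoning

  module _ (2≤n : 2 ℕ.≤ n) where

    -- A trivial product excludes y and contains both or neither of xz and z. The remaining factors
    -- are rotations and commute, so the exponent is j with 1 ≤ j < n, or j + 1 with j + 2 ≤ n; n
    -- divides neither.
    no-short : ∀ {T} → T ⊆ extremal → 1 ℕ.≤ length T → length T ℕ.≤ n → ¬ OneInπ n T
    no-short T⊆ 1≤ ≤n (T′ , perm , e) with ⊆-++⁻ (replicate (ℕ.pred n) x) T⊆
    ... | as , bs , refl , as⊆ , bs⊆ with ⊆-replicate (ℕ.pred n) as⊆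
    ...   | j , refl , j≤ = cases bs⊆ flags≡ nonempty small exponent-∣
      where
      i = + toℕ (fin n 1)
      i≡1 : i ≡ 1ℤ
      i≡1 = cong (λ k → + k) (trans (toℕ-fromℕ< (m%n<n 1 n)) (m<n⇒m%n≡m 2≤n))
      triv : Trivial n (π (map ι T′))
      triv = one⇒trivial (prod-∼ (ι-∼ T′)) e
      permι : map ι T′ ↭ replicate j (ι x) ++ map ι bs
      permι = ↭-trans (map⁺ ι perm)
          (↭-reflexive (trans (Listₚ.map-++ ι (replicate j x) bs)
          (cong (_++ map ι bs) (Listₚ.map-replicate ι j x))))
      flags≡ : proj₂ (total (map ι bs)) ≡ (false , false)
      flags≡ = trans (sym (flags-replicate j i (map ι bs)))
          (trans (cong proj₂ (trans (sym (total-↭ permι)) (sym (class-π (map ι T′)))))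
        (cong₂ _,_ (rotation triv) (central-trivial triv)))
      nonempty : 1 ℕ.≤ j ℕ.+ length bs
      nonempty = subst (1 ℕ.≤_)
          (trans (length-++ (replicate j x)) (cong (ℕ._+ length bs) (Listₚ.length-replicate j))) 1≤
      small : j ℕ.+ length bs ℕ.≤ n
      small = subst (ℕ._≤ n)
          (trans (length-++ (replicate j x)) (cong (ℕ._+ length bs) (Listₚ.length-replicate j))) ≤n
      rots : All Rotation (map ι bs) → All Rotation (replicate j (ι x) ++ map ι bs)
      rots rs = Allₚ.++⁺ (Allₚ.replicate⁺ j refl) rs
      exponent-∣ : All Rotation (map ι bs) → + n ∣ + j + ex (π (map ι bs))
      exponent-∣ rs = subst (+ n ∣_)
          (trans (cong ex (sym (π-rotations-↭ (rots rs) (↭-sym permι)))) (trans (π-replicate j i (map ι bs))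
        (cong (_+ ex (π (map ι bs))) (trans (cong (+ j *_) i≡1) (ℤₚ.*-identityʳ (+ j)))))) (n∣ex triv)
      nothing : + n ∣ + j + 0ℤ → 1 ℕ.≤ j → ⊥
      nothing d 1≤j = ℕ∣.>⇒∤ {{ℕ.>-nonZero 1≤j}} (ℕₚ.≤-trans (s≤s j≤) (ℕₚ.≤-reflexive (ℕₚ.suc-pred n)))
        (∣⇒∣ᵤ (subst (+ n ∣_) (ℤₚ.+-identityʳ (+ j)) d))
      both : + n ∣ + j + 1ℤ → j ℕ.+ 2 ℕ.≤ n → ⊥
      both d l = ℕ∣.>⇒∤ {{ℕ.>-nonZero (ℕₚ.m≤n+m 1 j)}} (ℕₚ.≤-trans (ℕₚ.≤-reflexive (sym (ℕₚ.+-suc j 1))) l)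
          (∣⇒∣ᵤ d)
      cases : ∀ {bs} → bs ⊆ xz ∷ z ∷ y ∷ [] → proj₂ (total (map ι bs)) ≡ (false , false) →
        1 ℕ.≤ j ℕ.+ length bs → j ℕ.+ length bs ℕ.≤ n →
        (All Rotation (map ι bs) → + n ∣ + j + ex (π (map ι bs))) → ⊥
      cases (_ ∷ʳ _ ∷ʳ _ ∷ʳ []) _ l _ d = nothing (d []) (subst (1 ℕ.≤_) (ℕₚ.+-identityʳ j) l)
      cases (refl ∷ refl ∷ _ ∷ʳ []) _ _ l d =
          both (subst (λ k → + n ∣ + j + k) exponent (d (refl ∷ refl ∷ []))) l
        where
        exponent : i + (+ toℕ (fin n 0) + 0ℤ) ≡ 1ℤ
        exponent = cong₂ (λ k l → k + (l + 0ℤ)) i≡1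
            (cong (λ k → + k) (trans (toℕ-fromℕ< (m%n<n 0 n)) (m<n⇒m%n≡m (ℕₚ.≤-trans (s≤s z≤n) 2≤n))))
      cases (refl ∷ _ ∷ʳ _ ∷ʳ []) ()
      cases (_ ∷ʳ refl ∷ _ ∷ʳ []) ()
      cases (_ ∷ʳ _ ∷ʳ refl ∷ []) ()
      cases (refl ∷ _ ∷ʳ refl ∷ []) ()
      cases (_ ∷ʳ refl ∷ refl ∷ []) ()
      cases (refl ∷ refl ∷ refl ∷ []) ()

    ¬EtaProp : ∀ {ℓ} → ℓ ℕ.≤ n ℕ.+ 2 → ¬ EtaProp n n ℓ
    ¬EtaProp ℓ≤ eta with eta extremal (ℕₚ.≤-trans ℓ≤ (ℕₚ.≤-reflexive (sym length-extremal)))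
    ... | T , T⊆ , 1≤ , ≤n , o = no-short T⊆ 1≤ ≤n o

theorem3p2 : ∀ (n : ℕ) .{{_ : ℕ.NonZero n}} → 4 ℕ.≤ n → 2 ℕ∣.∣ n →
    ∃[ e ] (IsExp n e
    × IsLeastPos (SProp n e) (2 ℕ.* n ℕ.+ 2)
    × IsLeastPos (EtaProp n e) (n ℕ.+ 3)
    × 2 ℕ.* n ℕ.+ 2 ≡ (n ℕ.+ 3) ℕ.+ e ℕ.∸ 1)
theorem3p2 n 4≤n 2∣n = n , isExp 2≤n 2∣n
  , (ℕₚ.m≤n⇒m≤o+n (2 ℕ.* n) (s≤s z≤n) , s-bound , λ ℓ _ ℓ< s →
      -- A bound for s below 2n + 2 would give the bound n + 2 for η, which the extremal sequence of
      -- that length refutes.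
      ¬EtaProp 2≤n ℕₚ.≤-refl (SProp⇒EtaProp (ℕₚ.≤-trans ℓ< (ℕₚ.≤-reflexive (lem₁ n))) s))
  , (ℕₚ.m≤n⇒m≤o+n n (s≤s z≤n) , SProp⇒EtaProp (ℕₚ.≤-reflexive (lem₂ n)) s-bound
    , λ ℓ _ ℓ< → ¬EtaProp 2≤n (ℕ.s≤s⁻¹ (ℕₚ.≤-trans ℓ< (ℕₚ.≤-reflexive (ℕₚ.+-suc n 2)))))
  , cong ℕ.pred (lem₂ n)
  where
  2≤n : 2 ℕ.≤ n
  2≤n = ℕₚ.≤-trans (s≤s (s≤s z≤n)) 4≤n
  lem₁ : ∀ n → 2 ℕ.* n ℕ.+ 2 ≡ n ℕ.+ 2 ℕ.+ n
  lem₁ = ℕSolver.solve-∀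
  lem₂ : ∀ n → suc (2 ℕ.* n ℕ.+ 2) ≡ n ℕ.+ 3 ℕ.+ n
  lem₂ = ℕSolver.solve-∀
  hasBlock : 2 ℕ∣.∣ n → HasBlock n
  hasBlock (ℕ∣.divides m e) = subst HasBlock (sym eq)
      (hasBlock-even m (ℕₚ.*-cancelˡ-≤ 2 (subst (4 ℕ.≤_) eq 4≤n)))
    where
    eq : n ≡ 2 ℕ.* m
    eq = trans e (ℕₚ.*-comm m 2)
  s-bound : SProp n n (2 ℕ.* n ℕ.+ 2)
  s-bound = hasBlock⇒SProp (hasBlock 2∣n)
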